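{- For the generalized Bernoulli, Euler and Genocchi polynomials of order $\alpha\in\mathbb{C}$ in the variable $x$, and for every integer $p\ge 0$, with $i^2=-1$, the following lacunary relations of length 4 hold: (1) $$\sum_{\substack{0\le k\le p\\ k\equiv 2\ (\mathrm{mod}\ 4)}}\binom{p}{k}2^{1-k/2}(-1)^{(k+2)/4}B_{p-k}^{(\alpha+1)}(x)=\operatorname{Im}\left(p\,B_{p-1}^{(\alpha)}\left(x-\frac{1+i}{2}\right)\right);$$ (2) $$\sum_{\substack{0\le k\le p\\ k\equiv 0\ (\mathrm{mod}\ 4)}}\binom{p}{k}2^{1-k/2}(-1)^{k/4}E_{p-k}^{(\alpha+1)}(x)=\operatorname{Re}\left(2\,E_{p}^{(\alpha)}\left(x-\frac{1+i}{2}\right)\right);$$ (3) $$\sum_{\substack{0\le k\le p\\ k\equiv 0\ (\mathrm{mod}\ 4)}}\binom{p}{k}2^{1-k/2}(-1)^{k/4}G_{p-k}^{(\alpha+1)}(x)=\operatorname{Re}\left(2p\,G_{p-1}^{(\alpha)}\left(x-\frac{1+i}{2}\right)\right).$$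
   Context: The generalized Bernoulli polynomials $B_k^{(\alpha)}(x)$, Euler polynomials $E_k^{(\alpha)}(x)$ and Genocchi polynomials $G_k^{(\alpha)}(x)$ of order $\alpha\in\mathbb{C}$ are defined by the generating functions $$\left(\frac{t}{e^t-1}\right)^{\alpha}e^{xt}=\sum_{k=0}^\infty B_k^{(\alpha)}(x)\frac{t^k}{k!}\quad(|t|<2\pi),$$ $$\left(\frac{2}{e^t+1}\right)^{\alpha}e^{xt}=\sum_{k=0}^\infty E_k^{(\alpha)}(x)\frac{t^k}{k!}\quad(|t|<\pi),$$ $$\left(\frac{2t}{e^t+1}\right)^{\alpha}e^{xt}=\sum_{k=0}^\infty G_k^{(\alpha)}(x)\frac{t^k}{k!}\quad(|t|<\pi),$$ with $1^\alpha:=1$. Polynomials with negative index are zero by convention. $\operatorname{Re}$ and $\operatorname{Im}$ denote real and imaginary parts.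
   Formalization: Re and Im separate only the explicit i, treating α and x as real (literally, (2) fails for p=1, x=0, α=i); (3) is stated only for orders α = 0, 1, 2, …, since otherwise (2t/(e^t+1))^α has no power series at t=0 and G_k^(α) is undefined. -}

module Defs where

open import Algebra.Bundles using (CommutativeRing; AbelianGroup; Semiring)
open import Algebra.Structures using (IsCommutativeRing)
import Algebra.Construct.DirectProduct as DirectProduct
import Algebra.Definitions.RawSemiring as RawSemiringDefinitions
import Algebra.Properties.Ring as RingProperties
import Algebra.Solver.Ring.NaturalCoefficients.Default as NaturalSolver
open import Data.Bool.Base using (if_then_else_)
open import Data.Fin.Base using (toℕ)
open import Data.Integer.Base as ℤ using (ℤ; +_; -[1+_])
open import Data.Nat.Base as ℕ using (ℕ; zero; suc; NonZero; _!; _%_)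
open import Data.Nat.Properties using (_≟_; _!≢0)
open import Data.Product.Base using (_×_; _,_; proj₁; proj₂)
open import Level using (Level; _⊔_)
open import Relation.Nullary.Decidable using (does)
import Relation.Binary.Reasoning.Setoid as SetoidReasoning

-- A commutative ring in which every positive integer is invertible.  ℝ and ℂ
-- are instances; nothing else about them is needed to define the polynomials.
record ℚ-Algebra (c ℓ : Level) : Set (Level.suc (c ⊔ ℓ)) where
  field
    commutativeRing : CommutativeRing c ℓ
  open CommutativeRing commutativeRing public
  open RawSemiringDefinitions (Semiring.rawSemiring semiring) public
    using (_^_; sum) renaming (_×_ to _·_)
  field
    1/_         : (n : ℕ) .{{_ : NonZero n}} → Carrier
    1/-inverseʳ : (n : ℕ) .{{_ : NonZero n}} → (n · 1#) * (1/ n) ≈ 1#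

  1/!_ : ℕ → Carrier
  1/! n = (1/ (n !)) {{n !≢0}}

  2^_ : ℤ → Carrier
  2^ (+ n)    = (2 · 1#) ^ n
  2^ -[1+ n ] = (1/ 2) ^ suc n

  ∑≤ : ℕ → (ℕ → Carrier) → Carrier
  ∑≤ n f = sum {suc n} (λ i → f (toℕ i))

  -- The sum of f k over those 0 ≤ k ≤ n with k ≡ r (mod 4), for r < 4.
  ∑≤-mod4 : ℕ → ℕ → (ℕ → Carrier) → Carrier
  ∑≤-mod4 n r f = ∑≤ n (λ k → if does (k % 4 ≟ r) then f k else 0#)

  infix 3 ∑≤ ∑≤-mod4
  syntax ∑≤ n (λ k → t) = ∑[ k ≤ n ] t
  syntax ∑≤-mod4 n r (λ k → t) = ∑[ k ≤ n ][≡ r mod4] t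


module PowerSeries {c ℓ} (A : ℚ-Algebra c ℓ) where
  open ℚ-Algebra A

  -- f represents the formal power series Σ f(k) tᵏ (no factorials).
  Series : Set c
  Series = ℕ → Carrier

  infixl 7 _⊛_ _∙_
  infixl 6 _⊕_ _⊖_

  const : Carrier → Series
  const a zero    = a
  const a (suc _) = 0#

  t : Series
  t 1 = 1#
  t _ = 0#

  _⊕_ _⊖_ _⊛_ : Series → Series → Series
  (f ⊕ g) k = f k + g k
  (f ⊖ g) k = f k - g k
  (f ⊛ g) k = ∑[ j ≤ k ] f j * g (k ℕ.∸ j)

  _∙_ : Carrier → Series → Series
  (a ∙ f) k = a * f k

  -- Division by t of a series with constant coefficient 0.
  _/t : Series → Series
  (f /t) k = f (suc k)

  pow : Series → ℕ → Series
  pow f zero    = const 1#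
  pow f (suc n) = f ⊛ pow f n

  exp : Carrier → Series
  exp x k = x ^ k * 1/! k

  -- The reciprocal Σₙ (1 - f)ⁿ of a series f with constant coefficient 1.
  -- The terms with n > k do not contribute to the coefficient of tᵏ.
  recip : Series → Series
  recip f k = ∑[ n ≤ k ] pow (const 1# ⊖ f) n k

  falling : Carrier → ℕ → Carrier
  falling α zero    = 1#
  falling α (suc n) = falling α n * (α - n · 1#)

  binomial : Carrier → ℕ → Carrier
  binomial α n = falling α n * 1/! n

  -- The power f^α = Σₙ (α choose n) (f - 1)ⁿ of a series f with constant
  -- coefficient 1.  This is the branch with constant coefficient 1^α = 1.
  power : Series → Carrier → Series
  power f α k = ∑[ n ≤ k ] binomial α n * pow (f ⊖ const 1#) n k


module Polynomials {c ℓ} (A : ℚ-Algebra c ℓ) where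
  open ℚ-Algebra A
  open PowerSeries A

  -- t/(eᵗ-1), 2/(eᵗ+1) and 2t/(eᵗ+1).
  bernoulliBase eulerBase genocchiBase : Series
  bernoulliBase = recip ((exp 1# ⊖ const 1#) /t)
  eulerBase     = recip ((1/ 2) ∙ (exp 1# ⊕ const 1#))
  genocchiBase  = t ⊛ eulerBase

  -- k! times the coefficient of tᵏ, with value 0 at negative indices.
  egfCoefficient : Series → ℤ → Carrier
  egfCoefficient f (+ k)    = (k !) · f k
  egfCoefficient f -[1+ _ ] = 0#

  bernoulli euler : (α : Carrier) → ℤ → Carrier → Carrier
  bernoulli α k x = egfCoefficient (power bernoulliBase α ⊛ exp x) k
  euler     α k x = egfCoefficient (power eulerBase α ⊛ exp x) k

  -- 2t/(eᵗ+1) vanishes to first order at t = 0, so its α-th power has a power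
  -- series expansion in t only when α is a natural number.
  genocchi : (α : ℕ) → ℤ → Carrier → Carrier
  genocchi α k x = egfCoefficient (pow genocchiBase α ⊛ exp x) k


private
  module ComplexIdentities {c ℓ} (R : CommutativeRing c ℓ) where
    open CommutativeRing R
    open SetoidReasoning setoid
    open NaturalSolver commutativeSemiring

    -- The semiring solver has no negation, so - x is first replaced by m * x.
    private
      m : Carrier
      m = - 1#

      neg : ∀ x → - x ≈ m * x
      neg x = sym (RingProperties.-1*x≈-x ring x)

    assocRe : ∀ a b c d e f → (a * c - b * d) * e - (a * d + b * c) * f
                            ≈ a * (c * e - d * f) - b * (c * f + d * e)
    assocRe a b c d e f = begin
      (a * c - b * d) * e - (a * d + b * c) * f
        ≈⟨ +-cong (*-congʳ (+-congˡ (neg _))) (neg _) ⟩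
      (a * c + m * (b * d)) * e + m * ((a * d + b * c) * f)
        ≈⟨ solve 7 (λ a b c d e f m →
             (a :* c :+ m :* (b :* d)) :* e :+ m :* ((a :* d :+ b :* c) :* f)
             := a :* (c :* e :+ m :* (d :* f)) :+ m :* (b :* (c :* f :+ d :* e)))
             refl a b c d e f m ⟩
      a * (c * e + m * (d * f)) + m * (b * (c * f + d * e))
        ≈⟨ +-cong (*-congˡ (+-congˡ (neg _))) (neg _) ⟨
      a * (c * e - d * f) - b * (c * f + d * e) ∎

    assocIm : ∀ a b c d e f → (a * c - b * d) * f + (a * d + b * c) * e
                            ≈ a * (c * f + d * e) + b * (c * e - d * f)
    assocIm a b c d e f = begin
      (a * c - b * d) * f + (a * d + b * c) * e
        ≈⟨ +-congʳ (*-congʳ (+-congˡ (neg _))) ⟩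
      (a * c + m * (b * d)) * f + (a * d + b * c) * e
        ≈⟨ solve 7 (λ a b c d e f m →
             (a :* c :+ m :* (b :* d)) :* f :+ (a :* d :+ b :* c) :* e
             := a :* (c :* f :+ d :* e) :+ b :* (c :* e :+ m :* (d :* f)))
             refl a b c d e f m ⟩
      a * (c * f + d * e) + b * (c * e + m * (d * f))
        ≈⟨ +-congˡ (*-congˡ (+-congˡ (neg _))) ⟨
      a * (c * f + d * e) + b * (c * e - d * f) ∎

    distribRe : ∀ a b c d e f → a * (c + e) - b * (d + f)
                              ≈ (a * c - b * d) + (a * e - b * f)
    distribRe a b c d e f = begin
      a * (c + e) - b * (d + f)
        ≈⟨ +-congˡ (neg _) ⟩
      a * (c + e) + m * (b * (d + f))
        ≈⟨ solve 7 (λ a b c d e f m →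
             a :* (c :+ e) :+ m :* (b :* (d :+ f))
             := (a :* c :+ m :* (b :* d)) :+ (a :* e :+ m :* (b :* f)))
             refl a b c d e f m ⟩
      (a * c + m * (b * d)) + (a * e + m * (b * f))
        ≈⟨ +-cong (+-congˡ (neg _)) (+-congˡ (neg _)) ⟨
      (a * c - b * d) + (a * e - b * f) ∎

    distribIm : ∀ a b c d e f → a * (d + f) + b * (c + e)
                              ≈ (a * d + b * c) + (a * f + b * e)
    distribIm = solve 6 (λ a b c d e f →
      a :* (d :+ f) :+ b :* (c :+ e)
      := (a :* d :+ b :* c) :+ (a :* f :+ b :* e)) refl

    commIm : ∀ a b c d → a * d + b * c ≈ c * b + d * a
    commIm = solve 4 (λ a b c d → a :* d :+ b :* c := c :* b :+ d :* a) refl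


-- A[i] with i² = -1.  Re and Im are taken with respect to A: for A = ℝ they are
-- the usual ones.  For A = ℂ the adjoined i is a new square root of -1, so that
-- Re and Im separate only the explicitly written i and treat the elements of A
-- (order and argument of a polynomial) as if they were real.
module Complexification {c ℓ} (A : ℚ-Algebra c ℓ) where
  open ℚ-Algebra A
  open ComplexIdentities commutativeRing

  private
    module Add = AbelianGroup
      (DirectProduct.abelianGroup +-abelianGroup +-abelianGroup)

  open Add public using () renaming
    (Carrier to Complex; _≈_ to _≈ᶜ_; _∙_ to _+ᶜ_; ε to 0ᶜ; _⁻¹ to -ᶜ_)

  Re Im : Complex → Carrier
  Re = proj₁
  Im = proj₂

  real : Carrier → Complex
  real a = a , 0#

  i : Complex
  i = 0# , 1#

  _*ᶜ_ : Complex → Complex → Complex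
  (a , b) *ᶜ (c , d) = a * c - b * d , a * d + b * c

  private
    *ᶜ-comm : ∀ z w → (z *ᶜ w) ≈ᶜ (w *ᶜ z)
    *ᶜ-comm (a , b) (c , d) =
      +-cong (*-comm a c) (-‿cong (*-comm b d)) , commIm a b c d

    *ᶜ-cong : ∀ {z z′ w w′} → z ≈ᶜ z′ → w ≈ᶜ w′ → (z *ᶜ w) ≈ᶜ (z′ *ᶜ w′)
    *ᶜ-cong (p , q) (r , s) =
      +-cong (*-cong p r) (-‿cong (*-cong q s)) ,
      +-cong (*-cong p s) (*-cong q r)

    *ᶜ-identityˡ : ∀ z → (real 1# *ᶜ z) ≈ᶜ z
    *ᶜ-identityˡ (a , b) = 1*a-0*b≈a , 1*b+0*a≈b
      where
      open SetoidReasoning setoid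
      1*a-0*b≈a : 1# * a - 0# * b ≈ a
      1*a-0*b≈a = begin
        1# * a - 0# * b ≈⟨ +-cong (*-identityˡ a) (-‿cong (zeroˡ b)) ⟩
        a - 0#          ≈⟨ +-congˡ (RingProperties.-0#≈0# ring) ⟩
        a + 0#          ≈⟨ +-identityʳ a ⟩
        a               ∎
      1*b+0*a≈b : 1# * b + 0# * a ≈ b
      1*b+0*a≈b = begin
        1# * b + 0# * a ≈⟨ +-cong (*-identityˡ b) (zeroˡ a) ⟩
        b + 0#          ≈⟨ +-identityʳ b ⟩
        b               ∎

    *ᶜ-distribˡ : ∀ z w u → (z *ᶜ (w +ᶜ u)) ≈ᶜ ((z *ᶜ w) +ᶜ (z *ᶜ u))
    *ᶜ-distribˡ (a , b) (c , d) (e , f) =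
      distribRe a b c d e f , distribIm a b c d e f

    isCommutativeRing′ : IsCommutativeRing _≈ᶜ_ _+ᶜ_ _*ᶜ_ -ᶜ_ 0ᶜ (real 1#)
    isCommutativeRing′ = record
      { isRing = record
        { +-isAbelianGroup = Add.isAbelianGroup
        ; *-cong = λ {z} {z′} {w} {w′} → *ᶜ-cong {z} {z′} {w} {w′}
        ; *-assoc = λ { (a , b) (c , d) (e , f) →
                        assocRe a b c d e f , assocIm a b c d e f }
        ; *-identity = *ᶜ-identityˡ ,
            λ z → Add.trans (*ᶜ-comm z (real 1#)) (*ᶜ-identityˡ z)
        ; distrib = *ᶜ-distribˡ ,
            λ z w u → Add.trans (*ᶜ-comm (w +ᶜ u) z)
                        (Add.trans (*ᶜ-distribˡ z w u)
                          (Add.∙-cong (*ᶜ-comm z w) (*ᶜ-comm z u)))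
        }
      ; *-comm = *ᶜ-comm
      }

  complexRing : CommutativeRing c ℓ
  complexRing = record { isCommutativeRing = isCommutativeRing′ }

  private
    module ℂ = CommutativeRing complexRing
    open RawSemiringDefinitions (Semiring.rawSemiring ℂ.semiring)
      using () renaming (_×_ to _·ᶜ_)

    ·-real : ∀ n → (n ·ᶜ real 1#) ≈ᶜ real (n · 1#)
    ·-real zero    = refl , refl
    ·-real (suc n) = +-congˡ (proj₁ (·-real n)) ,
                     trans (+-identityˡ _) (proj₂ (·-real n))

    real-* : ∀ a b → (real a *ᶜ real b) ≈ᶜ real (a * b)
    real-* a b =
      trans (+-congˡ (trans (-‿cong (zeroˡ 0#)) (RingProperties.-0#≈0# ring)))
            (+-identityʳ (a * b)) ,
      trans (+-cong (zeroʳ a) (zeroˡ b)) (+-identityˡ 0#)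

    real-1/-inverseʳ : ∀ n .{{_ : NonZero n}} →
                       ((n ·ᶜ real 1#) *ᶜ real (1/ n)) ≈ᶜ real 1#
    real-1/-inverseʳ n =
      Add.trans (ℂ.*-congʳ {x = real (1/ n)} (·-real n))
        (Add.trans (real-* (n · 1#) (1/ n)) (1/-inverseʳ n , refl))

  complexification : ℚ-Algebra c ℓ
  complexification = record
    { commutativeRing = complexRing
    ; 1/_             = λ n → real (1/ n)
    ; 1/-inverseʳ     = λ n → real-1/-inverseʳ n
    }

{-# OPTIONS --safe #-}
module Submission where

-- Write w = (1+i)/2, z₊ = 1-w = (1-i)/2 and z₋ = -w.  Then
--
--   (eᵗ ∓ 1) e^(-wt) = e^(z₊t) ∓ e^(z₋t).
--
-- Since z₊² = -i/2 and z₋² = i/2, both numbers have fourth power -1/4, so the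
-- sequences Im(z₊ᵏ) - Im(z₋ᵏ) and Re(z₊ᵏ) + Re(z₋ᵏ) are multiplied by -1/4
-- when k grows by 4.  Comparing k = 0, 1, 2, 3 shows that they are the lacunary
-- coefficients of the left-hand sides (Im-powers, Re-powers).  Hence the
-- exponential generating functions of these coefficients are
-- S = (eᵗ-1) Im e^(-wt) and S = (eᵗ+1) Re e^(-wt) (Im-lacunary, Re-lacunary).
--
-- The left-hand sides are p! times the coefficients of tᵖ in S times the
-- generating function of order α+1 (egfCoefficient-⊛).  That function has one
-- more factor t/(eᵗ-1), 2/(eᵗ+1) or 2t/(eᵗ+1) than the one of order α
-- (power-suc), and the factor eᵗ-1 or eᵗ+1 of S cancels its denominator
-- (bernoulli-product, euler-product, genocchi-product).  What remains is t, 2 or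
-- 2t times f Im e^(-wt) or f Re e^(-wt), where f is the generating function of
-- order α (m for the Genocchi polynomials) at the argument x.  As f has coefficients in A, this is the imaginary
-- or real part of f e^(-wt), the generating function at the argument x-w
-- (ψ-product).
--
-- The facts on formal power series that carry this are proved over an arbitrary
-- ℚ-algebra, so that they hold over A and over A[i] alike: series form a
-- commutative ring, recip is an inverse, f^(α+1) = f^α f, and
-- e^((x+y)t) = e^(xt) e^(yt).  All these constructions commute with the inclusion
-- of A in A[i].

open import Defs
open import Algebra.Bundles using (CommutativeRing)
open import Algebra.Morphism.Structures using (IsRingHomomorphism)
open import Data.Bool.Base using (if_then_else_; true; false)
open import Data.Fin.Base using (toℕ)
open import Data.Fin.Properties using (toℕ<n)
open import Data.Integer.Base using (+_)
open import Data.Nat.Base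
  using (ℕ; zero; suc; NonZero; _∸_; _/_; _%_; _!; _≤_; _<_; z≤n; s≤s)
open import Data.Nat.Combinatorics using (_C_)
open import Data.Product.Base using (_×_; _,_; proj₁; proj₂)
open import Function.Base using (_∘_)
open import Level using (_⊔_)
open import Relation.Nullary.Decidable using (does)
import Algebra.Properties.CommutativeSemiring.Binomial as BinomialTheorem
import Algebra.Properties.Ring as RingProperties
import Algebra.Properties.Semiring.Exp as SemiringExp
import Algebra.Properties.Semiring.Mult as SemiringMult
import Algebra.Properties.Semiring.Sum as SemiringSum
import Algebra.Solver.Ring.NaturalCoefficients.Default as NaturalSolver
import Data.Integer.Base as ℤ
import Data.Integer.Properties as ℤ
import Data.Nat.Base as ℕ
import Data.Nat.Combinatorics as ℕ
import Data.Nat.DivMod as ℕ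
import Data.Nat.Properties as ℕ
import Relation.Binary.PropositionalEquality.Core as ≡
import Relation.Binary.Reasoning.Setoid as SetoidReasoning
open ≡ using (_≡_)

-- Finite sums, factorials and binomial coefficients.
module Arithmetic {c ℓ} (A : ℚ-Algebra c ℓ) where
  open ℚ-Algebra A
  open SetoidReasoning setoid
  open SemiringSum semiring public
    using (sum-cong-≋; sum-replicate-zero; ∑-distrib-+; ∑-comm;
           *-distribˡ-sum)
  open SemiringMult semiring public
    using (×1-homo-*; ×-assoc-*; ×-assocˡ; ×-congʳ)
  open RingProperties ring public
    using (-1*x≈-x; -0#≈0#; -‿distribˡ-*; -‿distribʳ-*; -‿+-comm;
           -‿involutive; x[y-z]≈xy-xz)
  module Solver = NaturalSolver commutativeSemiring

  ∑-cong : ∀ n {f g : ℕ → Carrier} →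
           (∀ k → k ≤ n → f k ≈ g k) → ∑≤ n f ≈ ∑≤ n g
  ∑-cong n f≈g = sum-cong-≋ (λ i → f≈g (toℕ i) (ℕ.s≤s⁻¹ (toℕ<n i)))

  ∑-zero : ∀ n {f : ℕ → Carrier} → (∀ k → f k ≈ 0#) → ∑≤ n f ≈ 0#
  ∑-zero n f≈0 =
    trans (∑-cong n (λ k _ → f≈0 k)) (sum-replicate-zero (suc n))

  ∑-+ : ∀ n (f g : ℕ → Carrier) → ∑≤ n (λ k → f k + g k) ≈ ∑≤ n f + ∑≤ n g
  ∑-+ n f g = ∑-distrib-+ {suc n} (f ∘ toℕ) (g ∘ toℕ)

  *-∑ : ∀ n a (f : ℕ → Carrier) → a * ∑≤ n f ≈ ∑≤ n (λ k → a * f k)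
  *-∑ n a f = *-distribˡ-sum {suc n} a (f ∘ toℕ)

  ∑-swap : ∀ m n (f : ℕ → ℕ → Carrier) →
           ∑≤ m (λ i → ∑≤ n (f i)) ≈ ∑≤ n (λ j → ∑≤ m (λ i → f i j))
  ∑-swap m n f = ∑-comm {suc m} {suc n} (λ i j → f (toℕ i) (toℕ j))

  ∑-truncate : ∀ {m n} {f : ℕ → Carrier} → m ≤ n →
               (∀ k → m < k → f k ≈ 0#) → ∑≤ n f ≈ ∑≤ m f
  ∑-truncate {zero} {zero}  z≤n f≈0 = refl
  ∑-truncate {zero} {suc n} z≤n f≈0 =
    +-congˡ (∑-zero n (λ k → f≈0 (suc k) (s≤s z≤n)))
  ∑-truncate {suc m} (s≤s m≤n) f≈0 =
    +-congˡ (∑-truncate m≤n (λ k m<k → f≈0 (suc k) (s≤s m<k)))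

  ·≈*1 : ∀ n a → n · a ≈ n · 1# * a
  ·≈*1 n a = begin
    n · a         ≈⟨ ×-congʳ n (*-identityˡ a) ⟨
    n · (1# * a)  ≈⟨ ×-assoc-* n 1# a ⟨
    n · 1# * a    ∎

  1/!-inverse : ∀ n → (n !) · 1# * 1/! n ≈ 1#
  1/!-inverse n = 1/-inverseʳ (n !) {{ℕ._!≢0 n}}

  nCk·k!·[n∸k]!≡n! : ∀ {n k} → k ≤ n → (n C k) ℕ.* (k ! ℕ.* (n ∸ k) !) ≡ n !
  nCk·k!·[n∸k]!≡n! {n} {k} k≤n =
    ≡.trans (≡.cong (ℕ._* (k ! ℕ.* (n ∸ k) !)) (ℕ.nCk≡n!/k![n-k]! k≤n))
            (ℕ.m/n*n≡m {{ℕ._!*_!≢0 k (n ∸ k)}} (ℕ.k![n∸k]!∣n! k≤n))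

  C·1≈!*1/!*1/! : ∀ {n k} → k ≤ n →
                  (n C k) · 1# ≈ (n !) · 1# * (1/! k * 1/! (n ∸ k))
  C·1≈!*1/!*1/! {n} {k} k≤n = begin
    nCk                        ≈⟨ *-identityʳ nCk ⟨
    nCk * 1#                   ≈⟨ *-congˡ (*-identityˡ 1#) ⟨
    nCk * (1# * 1#)            ≈⟨ *-congˡ (*-cong (1/!-inverse k) (1/!-inverse j)) ⟨
    nCk * ((k! * k!⁻¹) * (j! * j!⁻¹))
      ≈⟨ solve 5 (λ a b c d e → a :* ((b :* c) :* (d :* e))
           := a :* (b :* d) :* (c :* e)) refl nCk k! k!⁻¹ j! j!⁻¹ ⟩
    nCk * (k! * j!) * (k!⁻¹ * j!⁻¹)
      ≈⟨ *-congʳ (*-congˡ (×1-homo-* (k !) (j !))) ⟨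
    nCk * ((k ! ℕ.* j !) · 1#) * (k!⁻¹ * j!⁻¹)
      ≈⟨ *-congʳ (×1-homo-* (n C k) (k ! ℕ.* j !)) ⟨
    ((n C k) ℕ.* (k ! ℕ.* j !)) · 1# * (k!⁻¹ * j!⁻¹)
      ≡⟨ ≡.cong (λ m → m · 1# * (k!⁻¹ * j!⁻¹)) (nCk·k!·[n∸k]!≡n! k≤n) ⟩
    (n !) · 1# * (k!⁻¹ * j!⁻¹) ∎
    where
    open Solver
    j = n ∸ k
    nCk = (n C k) · 1#
    k! = (k !) · 1#
    j! = (j !) · 1#
    k!⁻¹ = 1/! k
    j!⁻¹ = 1/! j

  suc*1/!suc : ∀ n → suc n · 1# * 1/! (suc n) ≈ 1/! n
  suc*1/!suc n = begin
    a * b                          ≈⟨ *-identityˡ _ ⟨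
    1# * (a * b)                   ≈⟨ *-congʳ (1/!-inverse n) ⟨
    (n !) · 1# * 1/! n * (a * b)
      ≈⟨ solve 4 (λ f i a b → f :* i :* (a :* b) := a :* f :* b :* i) refl _ _ _ _ ⟩
    a * (n !) · 1# * b * 1/! n     ≈⟨ *-congʳ (*-congʳ (×1-homo-* (suc n) (n !))) ⟨
    (suc n !) · 1# * b * 1/! n     ≈⟨ *-congʳ (1/!-inverse (suc n)) ⟩
    1# * 1/! n                     ≈⟨ *-identityˡ _ ⟩
    1/! n                          ∎
    where
    open Solver
    a = suc n · 1#
    b = 1/! (suc n)

  ^-congˡ : ∀ n {x y} → x ≈ y → x ^ n ≈ y ^ n
  ^-congˡ = SemiringExp.^-congˡ semiring


-- The ring of formal power series.
module SeriesRing {c ℓ} (A : ℚ-Algebra c ℓ) where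
  open ℚ-Algebra A
  open PowerSeries A public
  open Arithmetic A
  open SetoidReasoning setoid

  infix 4 _≋_
  -- Coefficientwise equality.  It is a record so that the two series can be
  -- inferred from a proof of their equality.
  record _≋_ (f g : Series) : Set ℓ where
    constructor coefficients
    field
      at : ∀ k → f k ≈ g k
  open _≋_ public

  ⊛-cong : ∀ {f f′ g g′} → f ≋ f′ → g ≋ g′ → f ⊛ g ≋ f′ ⊛ g′
  ⊛-cong p q .at k = ∑-cong k (λ j _ → *-cong (at p j) (at q (k ∸ j)))

  ⊛-distribʳ : ∀ h f g → (f ⊕ g) ⊛ h ≋ (f ⊛ h) ⊕ (g ⊛ h)
  ⊛-distribʳ h f g .at k = trans
    (∑-cong k (λ j _ → distribʳ (h (k ∸ j)) (f j) (g j)))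
    (∑-+ k (λ j → f j * h (k ∸ j)) (λ j → g j * h (k ∸ j)))

  ∙-⊛ : ∀ a f g → (a ∙ f) ⊛ g ≋ a ∙ (f ⊛ g)
  ∙-⊛ a f g .at k = trans
    (∑-cong k (λ j _ → *-assoc a (f j) (g (k ∸ j))))
    (sym (*-∑ k a (λ j → f j * g (k ∸ j))))

  -- By induction on k, from (f ⊛ g)/t = f(0) (g/t) + (f/t) ⊛ g.
  ⊛-assoc-at : ∀ k f g h → ((f ⊛ g) ⊛ h) k ≈ (f ⊛ (g ⊛ h)) k
  ⊛-assoc-at zero f g h = begin
    (f 0 * g 0 + 0#) * h 0 + 0#  ≈⟨ +-congʳ (*-congʳ (+-identityʳ _)) ⟩
    f 0 * g 0 * h 0 + 0#         ≈⟨ +-congʳ (*-assoc _ _ _) ⟩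
    f 0 * (g 0 * h 0) + 0#       ≈⟨ +-congʳ (*-congˡ (+-identityʳ _)) ⟨
    f 0 * (g 0 * h 0 + 0#) + 0#  ∎
  ⊛-assoc-at (suc k) f g h = begin
    (f 0 * g 0 + 0#) * h (suc k) + ((f ⊛ g) /t ⊛ h) k
      ≈⟨ +-cong (*-congʳ (+-identityʳ _))
           (at (⊛-distribʳ h (f 0 ∙ (g /t)) (f /t ⊛ g)) k) ⟩
    f 0 * g 0 * h (suc k) + (((f 0 ∙ (g /t)) ⊛ h) k + (f /t ⊛ g ⊛ h) k)
      ≈⟨ +-cong (*-assoc _ _ _)
           (+-cong (at (∙-⊛ (f 0) (g /t) h) k) (⊛-assoc-at k (f /t) g h)) ⟩
    f 0 * (g 0 * h (suc k)) + (f 0 * (g /t ⊛ h) k + (f /t ⊛ (g ⊛ h)) k)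
      ≈⟨ +-assoc _ _ _ ⟨
    f 0 * (g 0 * h (suc k)) + f 0 * (g /t ⊛ h) k + (f /t ⊛ (g ⊛ h)) k
      ≈⟨ +-congʳ (distribˡ _ _ _) ⟨
    f 0 * (g 0 * h (suc k) + (g /t ⊛ h) k) + (f /t ⊛ (g ⊛ h)) k ∎

  -- The sum defining a coefficient of a product, with its last term split off.
  ⊛-last : ∀ k f g → (f ⊛ g) (suc k) ≈ f (suc k) * g 0 + (f ⊛ (g /t)) k
  ⊛-last zero f g = begin
    f 0 * g 1 + (f 1 * g 0 + 0#)  ≈⟨ solve 2 (λ a b → a :+ (b :+ con 0) := b :+ (a :+ con 0)) refl _ _ ⟩
    f 1 * g 0 + (f 0 * g 1 + 0#)  ∎
    where open Solver
  ⊛-last (suc k) f g = begin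
    f 0 * g (suc (suc k)) + (f /t ⊛ g) (suc k)
      ≈⟨ +-congˡ (⊛-last k (f /t) g) ⟩
    f 0 * g (suc (suc k)) + (f (suc (suc k)) * g 0 + (f /t ⊛ g /t) k)
      ≈⟨ solve 3 (λ a b c → a :+ (b :+ c) := b :+ (a :+ c)) refl _ _ _ ⟩
    f (suc (suc k)) * g 0 + (f 0 * g (suc (suc k)) + (f /t ⊛ g /t) k) ∎
    where open Solver

  -- The first term of one sum is the last term of the other.
  ⊛-comm-at : ∀ k f g → (f ⊛ g) k ≈ (g ⊛ f) k
  ⊛-comm-at zero    f g = +-congʳ (*-comm (f 0) (g 0))
  ⊛-comm-at (suc k) f g = begin
    f 0 * g (suc k) + (f /t ⊛ g) k  ≈⟨ +-cong (*-comm _ _) (⊛-comm-at k (f /t) g) ⟩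
    g (suc k) * f 0 + (g ⊛ f /t) k  ≈⟨ ⊛-last k g f ⟨
    (g ⊛ f) (suc k)                 ∎

  const-⊛ : ∀ a f → const a ⊛ f ≋ a ∙ f
  const-⊛ a f .at zero    = +-identityʳ (a * f 0)
  const-⊛ a f .at (suc k) = begin
    a * f (suc k) + ∑≤ k (λ j → 0# * f (k ∸ j))
      ≈⟨ +-congˡ (∑-zero k (λ j → zeroˡ (f (k ∸ j)))) ⟩
    a * f (suc k) + 0#  ≈⟨ +-identityʳ _ ⟩
    a * f (suc k)       ∎

  ⊛-comm : ∀ f g → f ⊛ g ≋ g ⊛ f
  ⊛-comm f g .at k = ⊛-comm-at k f g

  seriesRing : CommutativeRing c ℓ
  seriesRing = record
    { Carrier = Series
    ; _≈_ = _≋_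
    ; _+_ = _⊕_
    ; _*_ = _⊛_
    ; -_ = λ f k → - f k
    ; 0# = λ _ → 0#
    ; 1# = const 1#
    ; isCommutativeRing = record
      { isRing = record
        { +-isAbelianGroup = record
          { isGroup = record
            { isMonoid = record
              { isSemigroup = record
                { isMagma = record
                  { isEquivalence = record
                    { refl = coefficients λ _ → refl
                    ; sym = λ p → coefficients λ k → sym (at p k)
                    ; trans = λ p q → coefficients λ k → trans (at p k) (at q k)
                    }
                  ; ∙-cong = λ p q → coefficients λ k → +-cong (at p k) (at q k)
                  }
                ; assoc = λ f g h → coefficients λ k → +-assoc (f k) (g k) (h k)
                }
              ; identity = (λ f → coefficients λ k → +-identityˡ (f k)) ,
                           (λ f → coefficients λ k → +-identityʳ (f k))
              }
            ; inverse = (λ f → coefficients λ k → -‿inverseˡ (f k)) ,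
                        (λ f → coefficients λ k → -‿inverseʳ (f k))
            ; ⁻¹-cong = λ p → coefficients λ k → -‿cong (at p k)
            }
          ; comm = λ f g → coefficients λ k → +-comm (f k) (g k)
          }
        ; *-cong = ⊛-cong
        ; *-assoc = λ f g h → coefficients λ k → ⊛-assoc-at k f g h
        ; *-identity = identityˡ , λ f → ≋-trans (⊛-comm f (const 1#)) (identityˡ f)
        ; distrib =
            (λ h f g → ≋-trans (⊛-comm h (f ⊕ g)) (≋-trans (⊛-distribʳ h f g)
              (coefficients λ k → +-cong (⊛-comm-at k f h) (⊛-comm-at k g h)))) ,
            ⊛-distribʳ
        }
      ; *-comm = ⊛-comm
      }
    }
    where
    ≋-trans : ∀ {f g h} → f ≋ g → g ≋ h → f ≋ h
    ≋-trans p q .at k = trans (at p k) (at q k)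
    identityˡ : ∀ f → const 1# ⊛ f ≋ f
    identityˡ f .at k = trans (at (const-⊛ 1# f) k) (*-identityˡ (f k))

  module S = CommutativeRing seriesRing
  module SeriesSolver = NaturalSolver S.commutativeSemiring

  pow-cong : ∀ {f g} n → f ≋ g → pow f n ≋ pow g n
  pow-cong zero    f≋g = S.refl
  pow-cong (suc n) f≋g = ⊛-cong f≋g (pow-cong n f≋g)

  /t-cong : ∀ {f g} → f ≋ g → f /t ≋ g /t
  /t-cong f≋g .at k = at f≋g (suc k)

  t⊛-suc : ∀ f k → (t ⊛ f) (suc k) ≈ f k
  t⊛-suc f k = begin
    0# * f (suc k) + (t /t ⊛ f) k  ≈⟨ +-congʳ (zeroˡ _) ⟩
    0# + (t /t ⊛ f) k              ≈⟨ +-identityˡ _ ⟩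
    (t /t ⊛ f) k                   ≈⟨ at (⊛-cong t/t≋1 (S.refl {f})) k ⟩
    (const 1# ⊛ f) k               ≈⟨ at (S.*-identityˡ f) k ⟩
    f k                            ∎
    where
    t/t≋1 : t /t ≋ const 1#
    t/t≋1 .at zero    = refl
    t/t≋1 .at (suc k) = refl

  t⊛-zero : ∀ f → (t ⊛ f) 0 ≈ 0#
  t⊛-zero f = trans (+-identityʳ _) (zeroˡ (f 0))

  t⊛/t : ∀ {f} → f 0 ≈ 0# → t ⊛ f /t ≋ f
  t⊛/t {f} f₀≈0 .at zero    = trans (t⊛-zero (f /t)) (sym f₀≈0)
  t⊛/t {f} f₀≈0 .at (suc k) = t⊛-suc (f /t) k

  -- The composition a(h) = Σₙ a(n) hⁿ with a series h whose constant coefficient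
  -- is 0.  As for power, only the terms n ≤ k count in the coefficient of tᵏ.
  -- Both recip and power are of this form.
  compose : (ℕ → Carrier) → Series → Series
  compose a h k = ∑[ n ≤ k ] a n * pow h n k

  compose-cong : ∀ {a b h h′} → (∀ n → a n ≈ b n) → h ≋ h′ →
                 compose a h ≋ compose b h′
  compose-cong a≈b h≋h′ .at k =
    ∑-cong k (λ n _ → *-cong (a≈b n) (at (pow-cong n h≋h′) k))

  compose-+ : ∀ a b h →
              compose (λ n → a n + b n) h ≋ compose a h ⊕ compose b h
  compose-+ a b h .at k = trans
    (∑-cong k (λ n _ → distribʳ (pow h n k) (a n) (b n)))
    (∑-+ k (λ n → a n * pow h n k) (λ n → b n * pow h n k))

  pow-vanishes : ∀ {h} → h 0 ≈ 0# → ∀ n {k} → k < n → pow h n k ≈ 0#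
  pow-vanishes {h} h₀≈0 (suc n) {zero} _ = begin
    h 0 * pow h n 0 + 0#  ≈⟨ +-identityʳ _ ⟩
    h 0 * pow h n 0       ≈⟨ *-congʳ h₀≈0 ⟩
    0# * pow h n 0        ≈⟨ zeroˡ _ ⟩
    0#                    ∎
  pow-vanishes {h} h₀≈0 (suc n) {suc k} (s≤s k<n) = begin
    h 0 * pow h n (suc k) + (h /t ⊛ pow h n) k
      ≈⟨ +-cong (trans (*-congʳ h₀≈0) (zeroˡ _))
           (∑-zero k {λ j → h (suc j) * pow h n (k ∸ j)} λ j → trans
             (*-congˡ (pow-vanishes {h} h₀≈0 n (ℕ.≤-<-trans (ℕ.m∸n≤m k j) k<n)))
             (zeroʳ (h (suc j)))) ⟩
    0# + 0#  ≈⟨ +-identityˡ 0# ⟩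
    0#       ∎

  -- The inner sums can all be extended to n ≤ k, since the powers of h vanish to
  -- increasing order; then the two sums can be exchanged.
  ⊛-compose : ∀ {h} → h 0 ≈ 0# → ∀ a g k →
              (g ⊛ compose a h) k ≈ (∑[ n ≤ k ] a n * (g ⊛ pow h n) k)
  ⊛-compose {h} h₀≈0 a g k = begin
    (∑[ j ≤ k ] g j * ∑≤ (k ∸ j) (λ n → a n * pow h n (k ∸ j)))
      ≈⟨ ∑-cong k
           {λ j → g j * ∑≤ k (λ n → a n * pow h n (k ∸ j))}
           {λ j → g j * ∑≤ (k ∸ j) (λ n → a n * pow h n (k ∸ j))}
           (λ j _ → *-congˡ (∑-truncate (ℕ.m∸n≤m k j) (λ n k∸j<n →
             trans (*-congˡ (pow-vanishes {h} h₀≈0 n k∸j<n)) (zeroʳ (a n))))) ⟨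
    (∑[ j ≤ k ] g j * ∑≤ k (λ n → a n * pow h n (k ∸ j)))
      ≈⟨ ∑-cong k (λ j _ → *-∑ k (g j) (λ n → a n * pow h n (k ∸ j))) ⟩
    (∑[ j ≤ k ] ∑≤ k (λ n → g j * (a n * pow h n (k ∸ j))))
      ≈⟨ ∑-swap k k (λ j n → g j * (a n * pow h n (k ∸ j))) ⟩
    (∑[ n ≤ k ] ∑≤ k (λ j → g j * (a n * pow h n (k ∸ j))))
      ≈⟨ ∑-cong k (λ n _ → ∑-cong k (λ j _ →
           solve 3 (λ x y z → x :* (y :* z) := y :* (x :* z)) refl
             (g j) (a n) (pow h n (k ∸ j)))) ⟩
    (∑[ n ≤ k ] ∑≤ k (λ j → a n * (g j * pow h n (k ∸ j))))
      ≈⟨ ∑-cong k (λ n _ → *-∑ k (a n) (λ j → g j * pow h n (k ∸ j))) ⟨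
    (∑[ n ≤ k ] a n * (g ⊛ pow h n) k) ∎
    where open Solver

  -- a(h) = a(0) + h b(h), where b(n) = a(n+1).
  compose-suc : ∀ {h} → h 0 ≈ 0# → ∀ a →
                compose a h ≋ const (a 0) ⊕ h ⊛ compose (a ∘ suc) h
  compose-suc {h} h₀≈0 a .at zero = begin
    a 0 * 1# + 0#             ≈⟨ +-cong (*-identityʳ _) (sym (zeroˡ _)) ⟩
    a 0 + 0# * C₀             ≈⟨ +-congˡ (*-congʳ h₀≈0) ⟨
    a 0 + h 0 * C₀            ≈⟨ +-congˡ (+-identityʳ _) ⟨
    a 0 + (h 0 * C₀ + 0#)     ∎
    where C₀ = compose (a ∘ suc) h 0
  compose-suc {h} h₀≈0 a .at (suc k) = begin
    a 0 * 0# + (∑[ n ≤ k ] a (suc n) * (h 0 * pow h n (suc k) + (h /t ⊛ pow h n) k))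
      ≈⟨ +-cong (zeroʳ _) (∑-cong k
           {λ n → a (suc n) * (h 0 * pow h n (suc k) + (h /t ⊛ pow h n) k)}
           {λ n → a (suc n) * (h /t ⊛ pow h n) k}
           (λ n _ → *-congˡ
             (trans (+-congʳ (trans (*-congʳ h₀≈0) (zeroˡ _))) (+-identityˡ _)))) ⟩
    0# + (∑[ n ≤ k ] a (suc n) * (h /t ⊛ pow h n) k)
      ≈⟨ +-congˡ (⊛-compose h₀≈0 (a ∘ suc) (h /t) k) ⟨
    0# + (h /t ⊛ compose (a ∘ suc) h) k
      ≈⟨ +-congˡ (+-identityˡ _) ⟨
    0# + (0# + (h /t ⊛ compose (a ∘ suc) h) k)
      ≈⟨ +-congˡ (+-congʳ (trans (*-congʳ h₀≈0) (zeroˡ _))) ⟨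
    0# + (h 0 * compose (a ∘ suc) h (suc k) + (h /t ⊛ compose (a ∘ suc) h) k) ∎

  recip≋compose : ∀ f → recip f ≋ compose (λ _ → 1#) (const 1# ⊖ f)
  recip≋compose f .at k =
    ∑-cong k (λ n _ → sym (*-identityˡ (pow (const 1# ⊖ f) n k)))

  recip-at-0 : ∀ f → recip f 0 ≈ 1#
  recip-at-0 f = +-identityʳ 1#

  recip-cong : ∀ {f g} → f ≋ g → recip f ≋ recip g
  recip-cong {f} {g} f≋g .at k = ∑-cong k
    {λ n → pow (const 1# ⊖ f) n k} {λ n → pow (const 1# ⊖ g) n k}
    (λ n _ → at (pow-cong n (S.+-congˡ (S.-‿cong f≋g))) k)

  falling-cong : ∀ {α β} n → α ≈ β → falling α n ≈ falling β n
  falling-cong zero    α≈β = refl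
  falling-cong (suc n) α≈β = *-cong (falling-cong n α≈β) (+-congʳ α≈β)

  power≋compose : ∀ f α → power f α ≋ compose (binomial α) (f ⊖ const 1#)
  power≋compose f α .at k = refl

  power-cong : ∀ {f g α β} → f ≋ g → α ≈ β → power f α ≋ power g β
  power-cong {f} {g} {α} {β} f≋g α≈β = S.trans (power≋compose f α) (S.trans
    (compose-cong {binomial α} {binomial β}
      (λ n → *-congʳ (falling-cong n α≈β)) (S.+-congʳ f≋g))
    (S.sym (power≋compose g β)))

  -- The recursion that removes the first factor of a falling factorial, where
  -- the defining one removes the last.
  falling-suc : ∀ α n → falling (α + 1#) (suc n) ≈ (α + 1#) * falling α n
  falling-suc α zero = begin
    1# * (α + 1# - 0#)  ≈⟨ *-identityˡ _ ⟩
    α + 1# - 0#         ≈⟨ +-congˡ -0#≈0# ⟩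
    α + 1# + 0#         ≈⟨ +-identityʳ _ ⟩
    α + 1#              ≈⟨ *-identityʳ _ ⟨
    (α + 1#) * 1#       ∎
  falling-suc α (suc n) = begin
    falling (α + 1#) (suc n) * (α + 1# - (1# + n · 1#))
      ≈⟨ *-cong (falling-suc α n) cancel ⟩
    (α + 1#) * falling α n * (α - n · 1#)    ≈⟨ *-assoc _ _ _ ⟩
    (α + 1#) * (falling α n * (α - n · 1#))  ∎
    where
    open Solver
    cancel : α + 1# - (1# + n · 1#) ≈ α - n · 1#
    cancel = begin
      α + 1# - (1# + n · 1#)        ≈⟨ +-congˡ (-‿+-comm 1# (n · 1#)) ⟨
      α + 1# + (- 1# - n · 1#)
        ≈⟨ solve 4 (λ a u v w → a :+ u :+ (v :+ w) := a :+ w :+ (u :+ v)) refl _ _ _ _ ⟩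
      α - n · 1# + (1# - 1#)        ≈⟨ +-congˡ (-‿inverseʳ 1#) ⟩
      α - n · 1# + 0#               ≈⟨ +-identityʳ _ ⟩
      α - n · 1#                    ∎

  -- The coefficients of u a(u) for a(u) = Σₙ a(n) uⁿ.
  shift : (ℕ → Carrier) → ℕ → Carrier
  shift a zero    = 0#
  shift a (suc n) = a n

  binomial-pascal : ∀ α n →
                    binomial (α + 1#) n ≈ binomial α n + shift (binomial α) n
  binomial-pascal α zero    = sym (+-identityʳ _)
  binomial-pascal α (suc n) = begin
    falling (α + 1#) (suc n) * 1/! (suc n)
      ≈⟨ *-congʳ (falling-suc α n) ⟩
    (α + 1#) * F * 1/! (suc n)
      ≈⟨ *-congʳ (*-congʳ (trans (+-congˡ (-‿inverseˡ ν)) (+-identityʳ _))) ⟨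
    (α + 1# + (- ν + ν)) * F * 1/! (suc n)
      ≈⟨ solve 6 (λ α u m ν F i → (α :+ u :+ (m :+ ν)) :* F :* i
           := F :* (α :+ m) :* i :+ F :* ((u :+ ν) :* i)) refl _ _ _ _ _ _ ⟩
    F * (α - ν) * 1/! (suc n) + F * (suc n · 1# * 1/! (suc n))
      ≈⟨ +-congˡ (*-congˡ (suc*1/!suc n)) ⟩
    F * (α - ν) * 1/! (suc n) + F * 1/! n ∎
    where
    open Solver
    F = falling α n
    ν = n · 1#

  exp-cong : ∀ {x y} → x ≈ y → exp x ≋ exp y
  exp-cong x≈y .at k = *-congʳ (^-congˡ k x≈y)

  exp-+ : ∀ x y → exp (x + y) ≋ exp x ⊛ exp y
  exp-+ x y .at k = begin
    (x + y) ^ k * 1/! k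
      ≈⟨ *-congʳ (BinomialTheorem.theorem commutativeSemiring k x y) ⟩
    (∑[ j ≤ k ] ((k C j) · (x ^ j * y ^ (k ∸ j)))) * 1/! k
      ≈⟨ trans (*-comm _ _) (*-∑ k (1/! k) (λ j → (k C j) · (x ^ j * y ^ (k ∸ j)))) ⟩
    (∑[ j ≤ k ] 1/! k * ((k C j) · (x ^ j * y ^ (k ∸ j))))
      ≈⟨ ∑-cong k (λ j j≤k → term j j≤k) ⟩
    (∑[ j ≤ k ] x ^ j * 1/! j * (y ^ (k ∸ j) * 1/! (k ∸ j))) ∎
    where
    open Solver
    term : ∀ j → j ≤ k → 1/! k * ((k C j) · (x ^ j * y ^ (k ∸ j)))
                         ≈ x ^ j * 1/! j * (y ^ (k ∸ j) * 1/! (k ∸ j))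
    term j j≤k = begin
      1/! k * ((k C j) · (X * Y))
        ≈⟨ *-congˡ (·≈*1 (k C j) (X * Y)) ⟩
      1/! k * ((k C j) · 1# * (X * Y))
        ≈⟨ *-congˡ (*-congʳ (C·1≈!*1/!*1/! j≤k)) ⟩
      1/! k * ((k !) · 1# * (1/! j * 1/! (k ∸ j)) * (X * Y))
        ≈⟨ solve 6 (λ ik k! ij il X Y → ik :* (k! :* (ij :* il) :* (X :* Y))
             := (k! :* ik) :* (X :* ij :* (Y :* il))) refl _ _ _ _ _ _ ⟩
      (k !) · 1# * 1/! k * (X * 1/! j * (Y * 1/! (k ∸ j)))
        ≈⟨ trans (*-congʳ (1/!-inverse k)) (*-identityˡ _) ⟩
      X * 1/! j * (Y * 1/! (k ∸ j)) ∎
      where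
      X = x ^ j
      Y = y ^ (k ∸ j)


-- Reciprocals and powers of series.
module SeriesPowers {c ℓ} (A : ℚ-Algebra c ℓ) where
  open ℚ-Algebra A
  open Arithmetic A
  open SeriesRing A
  open SetoidReasoning S.setoid

  -- With h = 1 - f, the geometric series R = recip f satisfies R = 1 + h R, and
  -- so does f R + h R = R.
  recip-inverse : ∀ {f} → f 0 ≈ 1# → recip f ⊛ f ≋ const 1#
  recip-inverse {f} f₀≈1 = S.trans (⊛-comm (recip f) f)
    (+-cancelʳ (h ⊛ recip f) (f ⊛ recip f) (const 1#) (begin
      f ⊛ recip f ⊕ h ⊛ recip f  ≈⟨ S.distribʳ (recip f) f h ⟨
      (f ⊕ h) ⊛ recip f          ≈⟨ S.*-congʳ f+h≋1 ⟩
      const 1# ⊛ recip f         ≈⟨ S.*-identityˡ (recip f) ⟩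
      recip f                    ≈⟨ recip≋compose f ⟩
      compose (λ _ → 1#) h       ≈⟨ compose-suc {h} h₀≈0 (λ _ → 1#) ⟩
      const 1# ⊕ h ⊛ compose (λ _ → 1#) h
        ≈⟨ S.+-congˡ (S.*-congˡ {h} (recip≋compose f)) ⟨
      const 1# ⊕ h ⊛ recip f     ∎))
    where
    open RingProperties S.ring using (+-cancelʳ)
    h = const 1# ⊖ f
    h₀≈0 : h 0 ≈ 0#
    h₀≈0 = trans (+-congˡ (-‿cong f₀≈1)) (-‿inverseʳ 1#)
    f+h≋1 : f ⊕ h ≋ const 1#
    f+h≋1 = coefficients λ k → xyx⁻¹≈y (f k) (const 1# k)
      where
      xyx⁻¹≈y : ∀ x y → x + (y - x) ≈ y
      xyx⁻¹≈y x y = trans (solve 3 (λ x y m → x :+ (y :+ m) := y :+ (x :+ m)) refl x y (- x))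
        (trans (+-congˡ (-‿inverseʳ x)) (+-identityʳ y))
        where open Solver

  -- With h = f - 1, the Pascal rule gives f^(α+1) = f^α + h f^α.
  power-suc : ∀ {f} → f 0 ≈ 1# → ∀ α → power f (α + 1#) ≋ power f α ⊛ f
  power-suc {f} f₀≈1 α = begin
    power f (α + 1#)                      ≈⟨ power≋compose f (α + 1#) ⟩
    compose (binomial (α + 1#)) h         ≈⟨ compose-cong (binomial-pascal α) S.refl ⟩
    compose (λ n → b n + shift b n) h     ≈⟨ compose-+ b (shift b) h ⟩
    compose b h ⊕ compose (shift b) h     ≈⟨ S.+-congˡ (compose-suc h₀≈0 (shift b)) ⟩
    P ⊕ (const 0# ⊕ h ⊛ P)                ≈⟨ S.+-congˡ (S.+-congʳ const-0) ⟩
    P ⊕ (S.0# ⊕ h ⊛ P)                    ≈⟨ S.+-congˡ (S.+-identityˡ (h ⊛ P)) ⟩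
    P ⊕ h ⊛ P                             ≈⟨ S.+-congʳ (S.*-identityˡ P) ⟨
    const 1# ⊛ P ⊕ h ⊛ P                  ≈⟨ S.distribʳ P (const 1#) h ⟨
    (const 1# ⊕ h) ⊛ P                    ≈⟨ S.*-congʳ 1+h≋f ⟩
    f ⊛ P                                 ≈⟨ ⊛-comm f P ⟩
    P ⊛ f                                 ≈⟨ S.*-congʳ (power≋compose f α) ⟨
    power f α ⊛ f                         ∎
    where
    b = binomial α
    h = f ⊖ const 1#
    P = compose b h
    h₀≈0 : h 0 ≈ 0#
    h₀≈0 = trans (+-congʳ f₀≈1) (-‿inverseʳ 1#)
    const-0 : const 0# ≋ S.0#
    const-0 .at zero    = refl
    const-0 .at (suc k) = refl
    1+h≋f : const 1# ⊕ h ≋ f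
    1+h≋f = begin
      const 1# ⊕ (f ⊕ S.- const 1#)  ≈⟨ S.+-congˡ (S.+-comm f (S.- const 1#)) ⟩
      const 1# ⊕ (S.- const 1# ⊕ f)  ≈⟨ S.+-assoc (const 1#) (S.- const 1#) f ⟨
      const 1# ⊕ S.- const 1# ⊕ f    ≈⟨ S.+-congʳ (S.-‿inverseʳ (const 1#)) ⟩
      S.0# ⊕ f                       ≈⟨ S.+-identityˡ f ⟩
      f                              ∎



-- Compatibility with homomorphisms of ℚ-algebras.
module BaseChange {c ℓ c′ ℓ′} (A : ℚ-Algebra c ℓ) (B : ℚ-Algebra c′ ℓ′)
  (φ : ℚ-Algebra.Carrier A → ℚ-Algebra.Carrier B)
  (φ-isRingHomomorphism :
    IsRingHomomorphism (ℚ-Algebra.rawRing A) (ℚ-Algebra.rawRing B) φ)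
  (1/-homo : ∀ n .{{_ : NonZero n}} →
    ℚ-Algebra._≈_ B (φ (ℚ-Algebra.1/_ A n)) (ℚ-Algebra.1/_ B n))
  where
  private
    module A where
      open ℚ-Algebra A public
      open SeriesRing A public
      open Polynomials A public
    module B where
      open ℚ-Algebra B public
      open SeriesRing B public
      open Polynomials B public
  open IsRingHomomorphism φ-isRingHomomorphism
  open Arithmetic B using (∑-cong)
  open B using (_≋_; coefficients; at; _⊛_; _⊖_; module S)

  -- Applying φ to every coefficient.
  map : A.Series → B.Series
  map f = φ ∘ f

  ·-homo : ∀ n a → φ (n A.· a) B.≈ n B.· φ a
  ·-homo zero    a = 0#-homo
  ·-homo (suc n) a = B.trans (+-homo a (n A.· a)) (B.+-congˡ (·-homo n a))

  ^-homo : ∀ a n → φ (a A.^ n) B.≈ φ a B.^ n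
  ^-homo a zero    = 1#-homo
  ^-homo a (suc n) = B.trans (*-homo a (a A.^ n)) (B.*-congˡ (^-homo a n))

  minus-homo : ∀ a b → φ (a A.- b) B.≈ φ a B.- φ b
  minus-homo a b = B.trans (+-homo a (A.- b)) (B.+-congˡ (-‿homo b))

  ∑-homo : ∀ n f → φ (A.∑≤ n f) B.≈ B.∑≤ n (φ ∘ f)
  ∑-homo zero    f = B.trans (+-homo (f 0) A.0#) (B.+-congˡ 0#-homo)
  ∑-homo (suc n) f = B.trans (+-homo (f 0) _) (B.+-congˡ (∑-homo n (f ∘ suc)))

  map-cong : ∀ {f g} → f A.≋ g → map f ≋ map g
  map-cong f≋g .at k = ⟦⟧-cong (A.at f≋g k)

  ⊛-homo : ∀ f g → map (f A.⊛ g) ≋ map f ⊛ map g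
  ⊛-homo f g .at k = B.trans
    (∑-homo k (λ j → f j A.* g (k ∸ j)))
    (∑-cong k (λ j _ → *-homo (f j) (g (k ∸ j))))

  const-1-homo : map (A.const A.1#) ≋ B.const B.1#
  const-1-homo .at zero    = 1#-homo
  const-1-homo .at (suc k) = 0#-homo

  ⊖-homo : ∀ f g → map (f A.⊖ g) ≋ map f ⊖ map g
  ⊖-homo f g .at k = minus-homo (f k) (g k)

  pow-homo : ∀ f n → map (A.pow f n) ≋ B.pow (map f) n
  pow-homo f zero    = const-1-homo
  pow-homo f (suc n) = S.trans (⊛-homo f (A.pow f n)) (S.*-congˡ {map f} (pow-homo f n))

  compose-homo : ∀ a h → map (A.compose a h) ≋ B.compose (φ ∘ a) (map h)
  compose-homo a h .at k = B.trans
    (∑-homo k (λ n → a n A.* A.pow h n k))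
    (∑-cong k (λ n _ → B.trans (*-homo (a n) (A.pow h n k))
                               (B.*-congˡ (at (pow-homo h n) k))))

  exp-homo : ∀ x → map (A.exp x) ≋ B.exp (φ x)
  exp-homo x .at k = B.trans (*-homo (x A.^ k) (A.1/! k))
    (B.*-cong (^-homo x k) (1/-homo (k !) {{ℕ._!≢0 k}}))

  recip-homo : ∀ f → map (A.recip f) ≋ B.recip (map f)
  recip-homo f = S.trans (map-cong (A.recip≋compose f)) (S.trans
    (compose-homo (λ _ → A.1#) (A.const A.1# A.⊖ f)) (S.trans
    (B.compose-cong (λ _ → 1#-homo)
      (S.trans (⊖-homo (A.const A.1#) f) (S.+-congʳ const-1-homo)))
    (S.sym (B.recip≋compose (map f)))))

  falling-homo : ∀ α n → φ (A.falling α n) B.≈ B.falling (φ α) n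
  falling-homo α zero    = 1#-homo
  falling-homo α (suc n) = B.trans
    (*-homo (A.falling α n) (α A.- n A.· A.1#))
    (B.*-cong (falling-homo α n) (B.trans (minus-homo α (n A.· A.1#))
      (B.+-congˡ (B.-‿cong (B.trans (·-homo n A.1#) (×-congʳ n 1#-homo))))))
    where open Arithmetic B using (×-congʳ)

  binomial-homo : ∀ α n → φ (A.binomial α n) B.≈ B.binomial (φ α) n
  binomial-homo α n = B.trans (*-homo (A.falling α n) (A.1/! n))
    (B.*-cong (falling-homo α n) (1/-homo (n !) {{ℕ._!≢0 n}}))

  power-homo : ∀ f α → map (A.power f α) ≋ B.power (map f) (φ α)
  power-homo f α = S.trans (map-cong (A.power≋compose f α)) (S.trans
    (compose-homo (A.binomial α) (f A.⊖ A.const A.1#)) (S.trans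
    (B.compose-cong {b = B.binomial (φ α)} (binomial-homo α)
      (S.trans (⊖-homo f (A.const A.1#)) (S.+-congˡ (S.-‿cong const-1-homo))))
    (S.sym (B.power≋compose (map f) (φ α)))))

  exp-1-homo : map (A.exp A.1#) ≋ B.exp B.1#
  exp-1-homo = S.trans (exp-homo A.1#) (B.exp-cong 1#-homo)

  bernoulliBase-homo : map A.bernoulliBase ≋ B.bernoulliBase
  bernoulliBase-homo = S.trans (recip-homo ((A.exp A.1# A.⊖ A.const A.1#) A./t))
    (B.recip-cong (B./t-cong (S.trans (⊖-homo (A.exp A.1#) (A.const A.1#))
      (S.+-cong exp-1-homo (S.-‿cong const-1-homo)))))

  eulerBase-homo : map A.eulerBase ≋ B.eulerBase
  eulerBase-homo = S.trans (recip-homo ((A.1/ 2) A.∙ (A.exp A.1# A.⊕ A.const A.1#)))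
    (B.recip-cong (coefficients λ k → B.trans
      (*-homo (A.1/ 2) (A.exp A.1# k A.+ A.const A.1# k))
      (B.*-cong (1/-homo 2) (B.trans (+-homo (A.exp A.1# k) (A.const A.1# k))
        (B.+-cong (at exp-1-homo k) (at const-1-homo k))))))

  t-homo : map A.t ≋ B.t
  t-homo .at zero          = 0#-homo
  t-homo .at (suc zero)    = 1#-homo
  t-homo .at (suc (suc k)) = 0#-homo

  genocchiBase-homo : map A.genocchiBase ≋ B.genocchiBase
  genocchiBase-homo = S.trans (⊛-homo A.t A.eulerBase)
    (S.*-cong t-homo eulerBase-homo)


-- Exponential generating functions.
module GeneratingFunctions {c ℓ} (A : ℚ-Algebra c ℓ) where
  open ℚ-Algebra A
  open Arithmetic A
  open SeriesRing A
  open Polynomials A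
  open SetoidReasoning setoid

  egfCoefficient-cong : ∀ {f g} → f ≋ g → ∀ n →
                        egfCoefficient f n ≈ egfCoefficient g n
  egfCoefficient-cong f≋g (+ k)      = ×-congʳ (k !) (at f≋g k)
  egfCoefficient-cong f≋g ℤ.-[1+ _ ] = refl

  +m-+n≡+[m∸n] : ∀ {m n} → n ≤ m → + m ℤ.- + n ≡ + (m ∸ n)
  +m-+n≡+[m∸n] {m} {n} n≤m = ≡.trans (ℤ.m-n≡m⊖n m n) (ℤ.⊖-≥ n≤m)

  -- A binomial convolution is a product of exponential generating functions.
  egfCoefficient-⊛ : ∀ (s : ℕ → Carrier) f p →
    (∑[ k ≤ p ] (p C k) · (s k * egfCoefficient f (+ p ℤ.- + k)))
    ≈ (p !) · ((λ k → s k * 1/! k) ⊛ f) p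
  egfCoefficient-⊛ s f p = begin
    (∑[ k ≤ p ] (p C k) · (s k * egfCoefficient f (+ p ℤ.- + k)))
      ≈⟨ ∑-cong p term ⟩
    (∑[ k ≤ p ] (p !) · 1# * (s k * 1/! k * f (p ∸ k)))
      ≈⟨ *-∑ p ((p !) · 1#) (λ k → s k * 1/! k * f (p ∸ k)) ⟨
    (p !) · 1# * ((λ k → s k * 1/! k) ⊛ f) p
      ≈⟨ ·≈*1 (p !) _ ⟨
    (p !) · ((λ k → s k * 1/! k) ⊛ f) p ∎
    where
    open Solver
    term : ∀ k → k ≤ p → (p C k) · (s k * egfCoefficient f (+ p ℤ.- + k))
                         ≈ (p !) · 1# * (s k * 1/! k * f (p ∸ k))
    term k k≤p = begin
      (p C k) · (s k * egfCoefficient f (+ p ℤ.- + k))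
        ≡⟨ ≡.cong (λ n → (p C k) · (s k * egfCoefficient f n)) (+m-+n≡+[m∸n] k≤p) ⟩
      (p C k) · (s k * ((p ∸ k) !) · f (p ∸ k))
        ≈⟨ ·≈*1 (p C k) _ ⟩
      (p C k) · 1# * (s k * ((p ∸ k) !) · f (p ∸ k))
        ≈⟨ *-cong (C·1≈!*1/!*1/! k≤p) (*-congˡ (·≈*1 ((p ∸ k) !) _)) ⟩
      (p !) · 1# * (1/! k * 1/! (p ∸ k)) * (s k * (((p ∸ k) !) · 1# * f (p ∸ k)))
        ≈⟨ solve 6 (λ p! ik ij s j! f → p! :* (ik :* ij) :* (s :* (j! :* f))
             := (j! :* ij) :* (p! :* (s :* ik :* f))) refl _ _ _ _ _ _ ⟩
      ((p ∸ k) !) · 1# * 1/! (p ∸ k) * ((p !) · 1# * (s k * 1/! k * f (p ∸ k)))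
        ≈⟨ trans (*-congʳ (1/!-inverse (p ∸ k))) (*-identityˡ _) ⟩
      (p !) · 1# * (s k * 1/! k * f (p ∸ k)) ∎

  egfCoefficient-t⊛ : ∀ f p →
    p · egfCoefficient f (+ p ℤ.- + 1) ≈ (p !) · (t ⊛ f) p
  egfCoefficient-t⊛ f zero    = sym (trans (+-identityʳ _) (t⊛-zero f))
  egfCoefficient-t⊛ f (suc p) = begin
    suc p · (p !) · f p           ≈⟨ ×-assocˡ (f p) (suc p) (p !) ⟩
    (suc p !) · f p               ≈⟨ ×-congʳ (suc p !) (t⊛-suc f p) ⟨
    (suc p !) · (t ⊛ f) (suc p)   ∎

  x^0/0!≈1 : ∀ x → exp x 0 ≈ 1#
  x^0/0!≈1 x = trans (*-congʳ (sym (+-identityʳ 1#))) (1/!-inverse 0)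

  e^t-1-at-0 : (exp 1# ⊖ const 1#) 0 ≈ 0#
  e^t-1-at-0 = trans (+-congʳ (x^0/0!≈1 1#)) (-‿inverseʳ 1#)

  bernoulliBase-inverse : bernoulliBase ⊛ (exp 1# ⊖ const 1#) /t ≋ const 1#
  bernoulliBase-inverse = recip-inverse (begin
    1# * 1# * 1/! 1 - 0#  ≈⟨ trans (+-congˡ -0#≈0#) (+-identityʳ _) ⟩
    1# * 1# * 1/! 1       ≈⟨ *-congʳ (trans (*-identityʳ 1#) (sym (+-identityʳ 1#))) ⟩
    1 · 1# * 1/! 1        ≈⟨ 1/!-inverse 1 ⟩
    1#                    ∎)
    where open SeriesPowers A

  ½+½≈1 : 1/ 2 + 1/ 2 ≈ 1#
  ½+½≈1 = trans (+-congˡ (sym (+-identityʳ (1/ 2))))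
    (trans (·≈*1 2 (1/ 2)) (1/-inverseʳ 2))

  eulerBase-inverse : eulerBase ⊛ ((1/ 2) ∙ (exp 1# ⊕ const 1#)) ≋ const 1#
  eulerBase-inverse = recip-inverse (begin
    1/ 2 * (exp 1# 0 + 1#)  ≈⟨ *-congˡ (+-congʳ (x^0/0!≈1 1#)) ⟩
    1/ 2 * (1# + 1#)        ≈⟨ trans (distribˡ _ _ _) (+-cong (*-identityʳ _) (*-identityʳ _)) ⟩
    1/ 2 + 1/ 2             ≈⟨ ½+½≈1 ⟩
    1#                      ∎)
    where open SeriesPowers A

  2⊛½∙ : ∀ f → const (2 · 1#) ⊛ ((1/ 2) ∙ f) ≋ f
  2⊛½∙ f .at k = begin
    (const (2 · 1#) ⊛ ((1/ 2) ∙ f)) k  ≈⟨ at (const-⊛ (2 · 1#) ((1/ 2) ∙ f)) k ⟩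
    2 · 1# * (1/ 2 * f k)            ≈⟨ *-assoc _ _ _ ⟨
    2 · 1# * 1/ 2 * f k              ≈⟨ *-congʳ (1/-inverseʳ 2) ⟩
    1# * f k                         ≈⟨ *-identityˡ _ ⟩
    f k                              ∎

  ·-const-⊛ : ∀ n m f k → m · (const (n · 1#) ⊛ f) k ≈ n · (m · f k)
  ·-const-⊛ n m f k = begin
    m · (const (n · 1#) ⊛ f) k  ≈⟨ ×-congʳ m (at (const-⊛ (n · 1#) f) k) ⟩
    m · (n · 1# * f k)          ≈⟨ ×-congʳ m (·≈*1 n (f k)) ⟨
    m · (n · f k)               ≈⟨ ×-assocˡ (f k) m n ⟩
    (m ℕ.* n) · f k             ≡⟨ ≡.cong (_· f k) (ℕ.*-comm m n) ⟩
    (n ℕ.* m) · f k             ≈⟨ ×-assocˡ (f k) n m ⟨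
    n · (m · f k)               ∎


-- Cancelling one factor of the base series.
module ProductIdentities {c ℓ} (A : ℚ-Algebra c ℓ) where
  open ℚ-Algebra A
  open SeriesRing A
  open SeriesPowers A
  open GeneratingFunctions A
  open Polynomials A
  open SeriesSolver
  open SetoidReasoning S.setoid

  bernoulli-product : ∀ α x s →
    ((exp 1# ⊖ const 1#) ⊛ s) ⊛ (power bernoulliBase (α + 1#) ⊛ exp x)
    ≋ t ⊛ (power bernoulliBase α ⊛ exp x ⊛ s)
  bernoulli-product α x s = begin
    ((exp 1# ⊖ const 1#) ⊛ s) ⊛ (power b (α + 1#) ⊛ X)
      ≈⟨ S.*-cong (S.*-congʳ {s} (S.sym (t⊛/t {D} e^t-1-at-0)))
                  (S.*-congʳ {X} (power-suc (recip-at-0 (D /t)) α)) ⟩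
    ((t ⊛ D /t) ⊛ s) ⊛ (Q ⊛ b ⊛ X)
      ≈⟨ solve 6 (λ t D s Q b X → ((t :* D) :* s) :* (Q :* b :* X)
           := (b :* D) :* (t :* (Q :* X :* s))) S.refl t (D /t) s Q b X ⟩
    (b ⊛ D /t) ⊛ (t ⊛ (Q ⊛ X ⊛ s))  ≈⟨ S.*-congʳ bernoulliBase-inverse ⟩
    const 1# ⊛ (t ⊛ (Q ⊛ X ⊛ s))    ≈⟨ S.*-identityˡ _ ⟩
    t ⊛ (Q ⊛ X ⊛ s)                 ∎
    where
    D = exp 1# ⊖ const 1#
    b = bernoulliBase
    Q = power b α
    X = exp x

  [eᵗ+1]⊛eulerBase : (exp 1# ⊕ const 1#) ⊛ eulerBase ≋ const (2 · 1#)
  [eᵗ+1]⊛eulerBase = begin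
    D ⊛ e                                    ≈⟨ S.*-congʳ {e} (2⊛½∙ D) ⟨
    (const (2 · 1#) ⊛ ((1/ 2) ∙ D)) ⊛ e
      ≈⟨ solve 3 (λ x y z → (x :* y) :* z := x :* (z :* y)) S.refl (const (2 · 1#)) ((1/ 2) ∙ D) e ⟩
    const (2 · 1#) ⊛ (e ⊛ ((1/ 2) ∙ D))
      ≈⟨ S.*-congˡ {const (2 · 1#)} eulerBase-inverse ⟩
    const (2 · 1#) ⊛ const 1#                ≈⟨ S.*-identityʳ _ ⟩
    const (2 · 1#)                           ∎
    where
    D = exp 1# ⊕ const 1#
    e = eulerBase

  euler-product : ∀ α x s →
    ((exp 1# ⊕ const 1#) ⊛ s) ⊛ (power eulerBase (α + 1#) ⊛ exp x)
    ≋ const (2 · 1#) ⊛ (power eulerBase α ⊛ exp x ⊛ s)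
  euler-product α x s = begin
    (D ⊛ s) ⊛ (power e (α + 1#) ⊛ X)
      ≈⟨ S.*-congˡ {D ⊛ s}
           (S.*-congʳ {X} (power-suc (recip-at-0 ((1/ 2) ∙ D)) α)) ⟩
    (D ⊛ s) ⊛ (Q ⊛ e ⊛ X)
      ≈⟨ solve 5 (λ D s Q e X → (D :* s) :* (Q :* e :* X)
           := (D :* e) :* (Q :* X :* s)) S.refl D s Q e X ⟩
    (D ⊛ e) ⊛ (Q ⊛ X ⊛ s)  ≈⟨ S.*-congʳ [eᵗ+1]⊛eulerBase ⟩
    const (2 · 1#) ⊛ (Q ⊛ X ⊛ s) ∎
    where
    D = exp 1# ⊕ const 1#
    e = eulerBase
    Q = power e α
    X = exp x

  genocchi-product : ∀ m x s →
    ((exp 1# ⊕ const 1#) ⊛ s) ⊛ (pow genocchiBase (m ℕ.+ 1) ⊛ exp x)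
    ≋ const (2 · 1#) ⊛ (t ⊛ (pow genocchiBase m ⊛ exp x ⊛ s))
  genocchi-product m x s = begin
    (D ⊛ s) ⊛ (pow genocchiBase (m ℕ.+ 1) ⊛ X)
      ≡⟨ ≡.cong (λ n → (D ⊛ s) ⊛ (pow genocchiBase n ⊛ X)) (ℕ.+-comm m 1) ⟩
    (D ⊛ s) ⊛ ((t ⊛ e) ⊛ Q ⊛ X)
      ≈⟨ solve 6 (λ D s t e Q X → (D :* s) :* (t :* e :* Q :* X)
           := (D :* e) :* (t :* (Q :* X :* s))) S.refl D s t e Q X ⟩
    (D ⊛ e) ⊛ (t ⊛ (Q ⊛ X ⊛ s))  ≈⟨ S.*-congʳ [eᵗ+1]⊛eulerBase ⟩
    const (2 · 1#) ⊛ (t ⊛ (Q ⊛ X ⊛ s)) ∎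
    where
    D = exp 1# ⊕ const 1#
    e = eulerBase
    Q = pow genocchiBase m
    X = exp x


-- The lacunary coefficients.
module Lacunary {c ℓ} (A : ℚ-Algebra c ℓ) where
  open ℚ-Algebra A
  open Arithmetic A
  open SetoidReasoning setoid

  -- The coefficient 2^(1-k/2) (-1)^(e k) for k ≡ r (mod 4), and 0 for other k.
  lacunary : ℕ → (ℕ → ℕ) → ℕ → Carrier
  lacunary r e k =
    if does (k % 4 ℕ.≟ r) then 2^ (+ 1 ℤ.- + (k / 2)) * (- 1#) ^ e k else 0#

  -- The exponent 1 - n is positive, zero or negative for n = 0, n = 1 and n ≥ 2.
  2^[1-[2+n]] : ∀ n → 2^ (+ 1 ℤ.- + (2 ℕ.+ n)) ≈ 1/ 2 * 1/ 2 * 2^ (+ 1 ℤ.- + n)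
  2^[1-[2+n]] zero = begin
    1/ 2 * 1#                         ≈⟨ *-congˡ (1/-inverseʳ 2) ⟨
    1/ 2 * (2 · 1# * 1/ 2)            ≈⟨ solve 2 (λ h d → h :* (d :* h) := h :* h :* d) refl _ _ ⟩
    1/ 2 * 1/ 2 * (2 · 1#)            ≈⟨ *-congˡ (*-identityʳ _) ⟨
    1/ 2 * 1/ 2 * (2 · 1# * 1#)       ∎
    where open Solver
  2^[1-[2+n]] (suc zero)    = sym (*-assoc (1/ 2) (1/ 2) 1#)
  2^[1-[2+n]] (suc (suc n)) = sym (*-assoc (1/ 2) (1/ 2) _)

  [4+k]/2 : ∀ k → (4 ℕ.+ k) / 2 ≡ 2 ℕ.+ k / 2
  [4+k]/2 k = ≡.trans (ℕ.m/n≡1+[m∸n]/n {4 ℕ.+ k} {2} (s≤s (s≤s z≤n)))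
    (≡.cong suc (ℕ.m/n≡1+[m∸n]/n {2 ℕ.+ k} {2} (s≤s (s≤s z≤n))))

  [4+k]/4 : ∀ k → (4 ℕ.+ k) / 4 ≡ suc (k / 4)
  [4+k]/4 k = ℕ.m/n≡1+[m∸n]/n {4 ℕ.+ k} {4} (s≤s (s≤s (s≤s (s≤s z≤n))))

  -- The condition k ≡ r (mod 4) is the same for 4 + k by computation of the
  -- remainder.
  lacunary-4+ : ∀ r e → (∀ k → e (4 ℕ.+ k) ≡ suc (e k)) → ∀ k →
    lacunary r e (4 ℕ.+ k) ≈ - (1/ 2 * 1/ 2) * lacunary r e k
  lacunary-4+ r e e-4+ k with does (k % 4 ℕ.≟ r)
  ... | false = sym (zeroʳ _)
  ... | true = begin
    2^ (+ 1 ℤ.- + ((4 ℕ.+ k) / 2)) * (- 1#) ^ e (4 ℕ.+ k)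
      ≡⟨ ≡.cong₂ (λ m n → 2^ (+ 1 ℤ.- + m) * (- 1#) ^ n) ([4+k]/2 k) (e-4+ k) ⟩
    2^ (+ 1 ℤ.- + (2 ℕ.+ k / 2)) * (- 1# * s)
      ≈⟨ *-congʳ (2^[1-[2+n]] (k / 2)) ⟩
    h * T * (- 1# * s)
      ≈⟨ solve 4 (λ h T m s → h :* T :* (m :* s) := m :* h :* (T :* s)) refl _ _ _ _ ⟩
    - 1# * h * (T * s)
      ≈⟨ *-congʳ (-1*x≈-x h) ⟩
    - h * (T * s) ∎
    where
    open Solver
    s = (- 1#) ^ e k
    h = 1/ 2 * 1/ 2
    T = 2^ (+ 1 ℤ.- + (k / 2))


-- Series with real coefficients inside the complexification.
module RealEmbedding {c ℓ} (A : ℚ-Algebra c ℓ) where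
  open ℚ-Algebra A
  open Arithmetic A
  open SeriesRing A
  open Complexification A public
  module ℂ where
    open ℚ-Algebra complexification public
    open SeriesRing complexification public
    open Polynomials complexification public

  real-isRingHomomorphism : IsRingHomomorphism rawRing ℂ.rawRing real
  real-isRingHomomorphism = record
    { isSemiringHomomorphism = record
      { isNearSemiringHomomorphism = record
        { +-isMonoidHomomorphism = record
          { isMagmaHomomorphism = record
            { isRelHomomorphism = record { cong = λ a≈b → a≈b , refl }
            ; homo = λ a b → refl , sym (+-identityˡ 0#)
            }
          ; ε-homo = refl , refl
          }
        ; *-homo = λ a b →
            sym (trans (+-congˡ (trans (-‿cong (zeroˡ 0#)) -0#≈0#)) (+-identityʳ _)) ,
            sym (trans (+-cong (zeroʳ a) (zeroˡ b)) (+-identityˡ 0#))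
        }
      ; 1#-homo = refl , refl
      }
    ; -‿homo = λ a → refl , sym -0#≈0#
    }

  open BaseChange A complexification real real-isRingHomomorphism
    (λ n → refl , refl) public


module RealCoefficients {c ℓ} (A : ℚ-Algebra c ℓ) where
  open SeriesRing A
  open RealEmbedding A
  open SetoidReasoning ℂ.S.setoid

  -- If Q′ has the coefficients of a series Q over A, then Q′ e^(xt) has those of
  -- Q e^(xt), so that e^(yt) is the only non-real factor of Q′ e^((x+y)t).
  map-product : ∀ {Q Q′} x y → map Q ℂ.≋ Q′ →
    Q′ ℂ.⊛ ℂ.exp (real x +ᶜ y) ℂ.≋ map (Q ⊛ exp x) ℂ.⊛ ℂ.exp y
  map-product {Q} {Q′} x y Q≋Q′ = begin
    Q′ ℂ.⊛ ℂ.exp (real x +ᶜ y)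
      ≈⟨ ℂ.S.*-cong (ℂ.S.sym Q≋Q′) (ℂ.exp-+ (real x) y) ⟩
    map Q ℂ.⊛ (ℂ.exp (real x) ℂ.⊛ ℂ.exp y)
      ≈⟨ ℂ.S.*-assoc (map Q) (ℂ.exp (real x)) (ℂ.exp y) ⟨
    (map Q ℂ.⊛ ℂ.exp (real x)) ℂ.⊛ ℂ.exp y
      ≈⟨ ℂ.S.*-congʳ {ℂ.exp y} (ℂ.S.*-congˡ {map Q} (exp-homo x)) ⟨
    (map Q ℂ.⊛ map (exp x)) ℂ.⊛ ℂ.exp y
      ≈⟨ ℂ.S.*-congʳ {ℂ.exp y} (⊛-homo Q (exp x)) ⟨
    map (Q ⊛ exp x) ℂ.⊛ ℂ.exp y ∎


-- Real and imaginary parts of series.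
module RealAndImaginaryParts {c ℓ} (A : ℚ-Algebra c ℓ) where
  open ℚ-Algebra A
  open Arithmetic A
  open SeriesRing A
  open Polynomials A
  open RealEmbedding A
  open RealCoefficients A
  open SetoidReasoning setoid

  -- A-linearity of a function from A[i] to A, with A acting on A[i] through real.
  record IsLinear (ψ : Complex → Carrier) : Set (c ⊔ ℓ) where
    field
      ψ-cong : ∀ {z w} → z ≈ᶜ w → ψ z ≈ ψ w
      ψ-+    : ∀ z w → ψ (z +ᶜ w) ≈ ψ z + ψ w
      ψ-0    : ψ 0ᶜ ≈ 0#
      ψ-*    : ∀ a z → ψ (real a *ᶜ z) ≈ a * ψ z

  Re-isLinear : IsLinear Re
  Re-isLinear = record
    { ψ-cong = proj₁
    ; ψ-+ = λ z w → refl
    ; ψ-0 = refl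
    ; ψ-* = λ a z → trans (+-congˡ (trans (-‿cong (zeroˡ _)) -0#≈0#)) (+-identityʳ _)
    }

  Im-isLinear : IsLinear Im
  Im-isLinear = record
    { ψ-cong = proj₂
    ; ψ-+ = λ z w → refl
    ; ψ-0 = refl
    ; ψ-* = λ a z → trans (+-congˡ (zeroˡ _)) (+-identityʳ _)
    }

  module Linear {ψ : Complex → Carrier} (isLinear : IsLinear ψ) where
    open IsLinear isLinear public

    ψ-∑ : ∀ n f → ψ (ℂ.∑≤ n f) ≈ ∑≤ n (ψ ∘ f)
    ψ-∑ zero    f = trans (ψ-+ (f 0) 0ᶜ) (+-congˡ ψ-0)
    ψ-∑ (suc n) f = trans (ψ-+ (f 0) _) (+-congˡ (ψ-∑ n (f ∘ suc)))

    ψ-⊛ : ∀ f G → ψ ∘ (map f ℂ.⊛ G) ≋ f ⊛ (ψ ∘ G)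
    ψ-⊛ f G .at k = trans
      (ψ-∑ k (λ j → real (f j) *ᶜ G (k ∸ j)))
      (∑-cong k (λ j _ → ψ-* (f j) (G (k ∸ j))))

    ψ-· : ∀ n z → ψ (n ℂ.· z) ≈ n · ψ z
    ψ-· zero    z = ψ-0
    ψ-· (suc n) z = trans (ψ-+ z (n ℂ.· z)) (+-congˡ (ψ-· n z))

    ψ-egfCoefficient : ∀ F n →
      ψ (ℂ.egfCoefficient F n) ≈ egfCoefficient (ψ ∘ F) n
    ψ-egfCoefficient F (+ k)      = ψ-· (k !) (F k)
    ψ-egfCoefficient F ℤ.-[1+ _ ] = ψ-0

    ψ-≋ : ∀ {F G} → F ℂ.≋ G → ψ ∘ F ≋ ψ ∘ G
    ψ-≋ F≋G .at k = ψ-cong (ℂ.at F≋G k)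

    ψ-exp : ∀ z k → ψ (ℂ.exp z k) ≈ ψ (z ℂ.^ k) * 1/! k
    ψ-exp z k = begin
      ψ ((z ℂ.^ k) *ᶜ real (1/! k))  ≈⟨ ψ-cong (ℂ.*-comm (z ℂ.^ k) (real (1/! k))) ⟩
      ψ (real (1/! k) *ᶜ (z ℂ.^ k))  ≈⟨ ψ-* (1/! k) (z ℂ.^ k) ⟩
      1/! k * ψ (z ℂ.^ k)            ≈⟨ *-comm _ _ ⟩
      ψ (z ℂ.^ k) * 1/! k            ∎

    -- A real factor can be moved out of a linear functional of a product.
    ψ-product : ∀ {Q Q′} x y → map Q ℂ.≋ Q′ →
      ψ ∘ (Q′ ℂ.⊛ ℂ.exp (real x +ᶜ y)) ≋ (Q ⊛ exp x) ⊛ (ψ ∘ ℂ.exp y)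
    ψ-product {Q} {Q′} x y Q≋Q′ =
      S.trans (ψ-≋ (map-product x y Q≋Q′)) (ψ-⊛ (Q ⊛ exp x) (ℂ.exp y))


-- Powers of (1-i)/2 and -(1+i)/2.
module EighthRoots {c ℓ} (A : ℚ-Algebra c ℓ) where
  open ℚ-Algebra A
  open Arithmetic A
  open GeneratingFunctions A using (½+½≈1)
  open Lacunary A
  open RealEmbedding A
  open RealAndImaginaryParts A
  open SetoidReasoning setoid

  private
    ½ : Carrier
    ½ = 1/ 2

  -- z₊ = (1-i)/2 and z₋ = -(1+i)/2.
  z₊ z₋ : Complex
  z₊ = ½ , - ½
  z₋ = - ½ , - ½

  ½[1+i] : Complex
  ½[1+i] = (ℂ.1/ 2) ℂ.* (ℂ.1# ℂ.+ i)

  ½[1+i]≈½,½ : ½[1+i] ≈ᶜ (½ , ½)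
  ½[1+i]≈½,½ =
    (begin
      ½ * (1# + 0#) - 0# * (0# + 1#)
        ≈⟨ +-cong (trans (*-congˡ (+-identityʳ 1#)) (*-identityʳ ½))
                  (trans (-‿cong (zeroˡ _)) -0#≈0#) ⟩
      ½ + 0#  ≈⟨ +-identityʳ ½ ⟩
      ½       ∎) ,
    (begin
      ½ * (0# + 1#) + 0# * (1# + 0#)
        ≈⟨ +-cong (trans (*-congˡ (+-identityˡ 1#)) (*-identityʳ ½)) (zeroˡ _) ⟩
      ½ + 0#  ≈⟨ +-identityʳ ½ ⟩
      ½       ∎)

  -½[1+i]≈z₋ : -ᶜ ½[1+i] ≈ᶜ z₋
  -½[1+i]≈z₋ = -‿cong (proj₁ ½[1+i]≈½,½) , -‿cong (proj₂ ½[1+i]≈½,½)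

  1-½[1+i]≈z₊ : real 1# +ᶜ -ᶜ ½[1+i] ≈ᶜ z₊
  1-½[1+i]≈z₊ =
    (begin
      1# - proj₁ ½[1+i]  ≈⟨ +-cong (sym ½+½≈1) (proj₁ -½[1+i]≈z₋) ⟩
      ½ + ½ - ½          ≈⟨ +-assoc ½ ½ (- ½) ⟩
      ½ + (½ - ½)        ≈⟨ +-congˡ (-‿inverseʳ ½) ⟩
      ½ + 0#             ≈⟨ +-identityʳ ½ ⟩
      ½                  ∎) ,
    trans (+-identityˡ _) (proj₂ -½[1+i]≈z₋)

  -*- : ∀ a b → - a * - b ≈ a * b
  -*- a b = trans (sym (-‿distribˡ-* a (- b)))
    (trans (-‿cong (sym (-‿distribʳ-* a b))) (-‿involutive (a * b)))

  ½½+½½≈½ : ½ * ½ + ½ * ½ ≈ ½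
  ½½+½½≈½ = trans (sym (distribˡ ½ ½ ½)) (trans (*-congˡ ½+½≈1) (*-identityʳ ½))

  z₊² : z₊ *ᶜ z₊ ≈ᶜ (0# , - ½)
  z₊² =
    trans (+-congˡ (-‿cong (-*- ½ ½))) (-‿inverseʳ (½ * ½)) ,
    (begin
      ½ * - ½ + - ½ * ½          ≈⟨ +-cong (-‿distribʳ-* ½ ½) (-‿distribˡ-* ½ ½) ⟨
      - (½ * ½) + - (½ * ½)      ≈⟨ -‿+-comm (½ * ½) (½ * ½) ⟩
      - (½ * ½ + ½ * ½)          ≈⟨ -‿cong ½½+½½≈½ ⟩
      - ½                        ∎)

  z₋² : z₋ *ᶜ z₋ ≈ᶜ (0# , ½)
  z₋² = -‿inverseʳ (- ½ * - ½) ,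
    trans (+-cong (-*- ½ ½) (-*- ½ ½)) ½½+½½≈½

  -- The powers of a number z with z² = qi and q² = 1/4.
  module Powers (z : Complex) (q : Carrier)
    (z²≈iq : z *ᶜ z ≈ᶜ (0# , q)) (q²≈¼ : q * q ≈ ½ * ½) where

    iq*iq≈-¼ : (0# , q) *ᶜ (0# , q) ≈ᶜ real (- (½ * ½))
    iq*iq≈-¼ =
      trans (+-cong (zeroˡ 0#) (-‿cong q²≈¼)) (+-identityˡ _) ,
      trans (+-cong (zeroˡ q) (zeroʳ q)) (+-identityˡ 0#)

    z¹ : (z ℂ.^ 1) ≈ᶜ z
    z¹ = ℂ.*-identityʳ z

    z² : (z ℂ.^ 2) ≈ᶜ (0# , q)
    z² = ℂ.trans (ℂ.*-congˡ {z} z¹) z²≈iq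

    z³ : (z ℂ.^ 3) ≈ᶜ (- (proj₂ z * q) , proj₁ z * q)
    z³ = ℂ.trans (ℂ.*-congˡ {z} z²)
      (trans (+-congʳ (zeroʳ _)) (+-identityˡ _) ,
       trans (+-congˡ (zeroʳ _)) (+-identityʳ _))

    z⁴⁺ : ∀ k → (z ℂ.^ (4 ℕ.+ k)) ≈ᶜ (real (- (½ * ½)) *ᶜ (z ℂ.^ k))
    z⁴⁺ k = ℂ.trans (zz* (z *ᶜ (z *ᶜ y)))
      (ℂ.trans (ℂ.*-congˡ {0# , q} (zz* y))
      (ℂ.trans (ℂ.sym (ℂ.*-assoc (0# , q) (0# , q) y)) (ℂ.*-congʳ {y} iq*iq≈-¼)))
      where
      y = z ℂ.^ k
      zz* : ∀ v → (z *ᶜ (z *ᶜ v)) ≈ᶜ ((0# , q) *ᶜ v)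
      zz* v = ℂ.trans (ℂ.sym (ℂ.*-assoc z z v)) (ℂ.*-congʳ {v} z²≈iq)

  module Z₊ = Powers z₊ (- ½) z₊² (-*- ½ ½)
  module Z₋ = Powers z₋ ½ z₋² refl

  ψ-^-4+ : ∀ {ψ} → IsLinear ψ → ∀ {z q} → (z *ᶜ z) ≈ᶜ (0# , q) → q * q ≈ ½ * ½ →
           ∀ k → ψ (z ℂ.^ (4 ℕ.+ k)) ≈ - (½ * ½) * ψ (z ℂ.^ k)
  ψ-^-4+ isLinear {z} {q} z²≈iq q²≈¼ k =
    trans (ψ-cong (Powers.z⁴⁺ z q z²≈iq q²≈¼ k)) (ψ-* _ _)
    where open IsLinear isLinear

  Im-powers : ∀ k → Im (z₊ ℂ.^ k) - Im (z₋ ℂ.^ k)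
                    ≈ lacunary 2 (λ k → (k ℕ.+ 2) / 4) k
  Im-powers 0 = -‿inverseʳ 0#
  Im-powers 1 = trans (+-cong (proj₂ Z₊.z¹) (-‿cong (proj₂ Z₋.z¹))) (-‿inverseʳ (- ½))
  Im-powers 2 = begin
    Im (z₊ ℂ.^ 2) - Im (z₋ ℂ.^ 2)  ≈⟨ +-cong (proj₂ Z₊.z²) (-‿cong (proj₂ Z₋.z²)) ⟩
    - ½ - ½                        ≈⟨ -‿+-comm ½ ½ ⟩
    - (½ + ½)                      ≈⟨ -‿cong ½+½≈1 ⟩
    - 1#                           ≈⟨ *-identityʳ _ ⟨
    - 1# * 1#                      ≈⟨ *-identityˡ _ ⟨
    1# * (- 1# * 1#)               ∎
  Im-powers 3 = begin
    Im (z₊ ℂ.^ 3) - Im (z₋ ℂ.^ 3)  ≈⟨ +-cong (proj₂ Z₊.z³) (-‿cong (proj₂ Z₋.z³)) ⟩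
    ½ * - ½ - - ½ * ½              ≈⟨ +-congʳ (*-comm ½ (- ½)) ⟩
    - ½ * ½ - - ½ * ½              ≈⟨ -‿inverseʳ _ ⟩
    0#                             ∎
  Im-powers (suc (suc (suc (suc k)))) = begin
    Im (z₊ ℂ.^ (4 ℕ.+ k)) - Im (z₋ ℂ.^ (4 ℕ.+ k))
      ≈⟨ +-cong (ψ-^-4+ Im-isLinear z₊² (-*- ½ ½) k)
                (-‿cong (ψ-^-4+ Im-isLinear z₋² refl k)) ⟩
    - (½ * ½) * Im (z₊ ℂ.^ k) - - (½ * ½) * Im (z₋ ℂ.^ k)
      ≈⟨ x[y-z]≈xy-xz _ _ _ ⟨
    - (½ * ½) * (Im (z₊ ℂ.^ k) - Im (z₋ ℂ.^ k))
      ≈⟨ *-congˡ (Im-powers k) ⟩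
    - (½ * ½) * lacunary 2 e k
      ≈⟨ lacunary-4+ 2 e (λ k → [4+k]/4 (k ℕ.+ 2)) k ⟨
    lacunary 2 e (4 ℕ.+ k) ∎
    where
    e : ℕ → ℕ
    e k = (k ℕ.+ 2) / 4

  Re-powers : ∀ k → Re (z₊ ℂ.^ k) + Re (z₋ ℂ.^ k) ≈ lacunary 0 (_/ 4) k
  Re-powers 0 = begin
    1# + 1#                      ≈⟨ +-congˡ (+-identityʳ 1#) ⟨
    2 · 1#                       ≈⟨ trans (*-identityʳ _) (*-identityʳ _) ⟨
    2 · 1# * 1# * 1#             ∎
  Re-powers 1 = trans (+-cong (proj₁ Z₊.z¹) (proj₁ Z₋.z¹)) (-‿inverseʳ ½)
  Re-powers 2 = trans (+-cong (proj₁ Z₊.z²) (proj₁ Z₋.z²)) (+-identityˡ 0#)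
  Re-powers 3 = begin
    Re (z₊ ℂ.^ 3) + Re (z₋ ℂ.^ 3)      ≈⟨ +-cong (proj₁ Z₊.z³) (proj₁ Z₋.z³) ⟩
    - (- ½ * - ½) + - (- ½ * ½)        ≈⟨ +-congˡ (-‿distribʳ-* (- ½) ½) ⟩
    - (- ½ * - ½) + - ½ * - ½          ≈⟨ -‿inverseˡ _ ⟩
    0#                                 ∎
  Re-powers (suc (suc (suc (suc k)))) = begin
    Re (z₊ ℂ.^ (4 ℕ.+ k)) + Re (z₋ ℂ.^ (4 ℕ.+ k))
      ≈⟨ +-cong (ψ-^-4+ Re-isLinear z₊² (-*- ½ ½) k)
                (ψ-^-4+ Re-isLinear z₋² refl k) ⟩
    - (½ * ½) * Re (z₊ ℂ.^ k) + - (½ * ½) * Re (z₋ ℂ.^ k)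
      ≈⟨ distribˡ _ _ _ ⟨
    - (½ * ½) * (Re (z₊ ℂ.^ k) + Re (z₋ ℂ.^ k))
      ≈⟨ *-congˡ (Re-powers k) ⟩
    - (½ * ½) * lacunary 0 (_/ 4) k
      ≈⟨ lacunary-4+ 0 (_/ 4) [4+k]/4 k ⟨
    lacunary 0 (_/ 4) (4 ℕ.+ k) ∎


-- The three relations.
module LacunaryRelations {c ℓ} (A : ℚ-Algebra c ℓ) where
  open ℚ-Algebra A
  open Arithmetic A
  open SeriesRing A
  open Polynomials A
  open GeneratingFunctions A
  open ProductIdentities A
  open Lacunary A
  open RealEmbedding A
  open RealAndImaginaryParts A
  open EighthRoots A
  open SetoidReasoning setoid

  -- The image of e^(-(1+i)t/2) under ψ, which is Re or Im below.
  s[_] : (Complex → Carrier) → Series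
  s[ ψ ] = ψ ∘ ℂ.exp (-ᶜ ½[1+i])

  -- eᵗ e^(-(1+i)t/2) = e^((1-i)t/2), and eᵗ has real coefficients.
  exp-1-⊛-s : ∀ {ψ} → IsLinear ψ → exp 1# ⊛ s[ ψ ] ≋ ψ ∘ ℂ.exp z₊
  exp-1-⊛-s isLinear = S.trans
    (S.sym (ψ-⊛ (exp 1#) (ℂ.exp (-ᶜ ½[1+i]))))
    (ψ-≋ (ℂ.S.trans (ℂ.S.*-congʳ {ℂ.exp (-ᶜ ½[1+i])} (exp-homo 1#))
         (ℂ.S.trans (ℂ.S.sym (ℂ.exp-+ (real 1#) (-ᶜ ½[1+i])))
                    (ℂ.exp-cong 1-½[1+i]≈z₊))))
    where open Linear isLinear

  1-⊛-s : ∀ {ψ} → IsLinear ψ → const 1# ⊛ s[ ψ ] ≋ ψ ∘ ℂ.exp z₋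
  1-⊛-s isLinear = S.trans (S.*-identityˡ _) (ψ-≋ (ℂ.exp-cong -½[1+i]≈z₋))
    where open Linear isLinear

  Im-lacunary : (exp 1# ⊖ const 1#) ⊛ s[ Im ]
                ≋ λ k → lacunary 2 (λ k → (k ℕ.+ 2) / 4) k * 1/! k
  Im-lacunary .at k = begin
    ((exp 1# ⊖ const 1#) ⊛ s[ Im ]) k
      ≈⟨ at ([y-z]x≈yx-zx s[ Im ] (exp 1#) (const 1#)) k ⟩
    (exp 1# ⊛ s[ Im ]) k - (const 1# ⊛ s[ Im ]) k
      ≈⟨ +-cong (at (exp-1-⊛-s Im-isLinear) k) (-‿cong (at (1-⊛-s Im-isLinear) k)) ⟩
    Im (ℂ.exp z₊ k) - Im (ℂ.exp z₋ k)
      ≈⟨ +-cong (ψ-exp z₊ k) (-‿cong (ψ-exp z₋ k)) ⟩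
    Im (z₊ ℂ.^ k) * 1/! k - Im (z₋ ℂ.^ k) * 1/! k
      ≈⟨ RingProperties.[y-z]x≈yx-zx ring _ _ _ ⟨
    (Im (z₊ ℂ.^ k) - Im (z₋ ℂ.^ k)) * 1/! k
      ≈⟨ *-congʳ (Im-powers k) ⟩
    lacunary 2 (λ k → (k ℕ.+ 2) / 4) k * 1/! k ∎
    where
    open RingProperties S.ring using ([y-z]x≈yx-zx)
    open Linear Im-isLinear

  Re-lacunary : (exp 1# ⊕ const 1#) ⊛ s[ Re ]
                ≋ λ k → lacunary 0 (_/ 4) k * 1/! k
  Re-lacunary .at k = begin
    ((exp 1# ⊕ const 1#) ⊛ s[ Re ]) k
      ≈⟨ at (S.distribʳ s[ Re ] (exp 1#) (const 1#)) k ⟩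
    (exp 1# ⊛ s[ Re ]) k + (const 1# ⊛ s[ Re ]) k
      ≈⟨ +-cong (at (exp-1-⊛-s Re-isLinear) k) (at (1-⊛-s Re-isLinear) k) ⟩
    Re (ℂ.exp z₊ k) + Re (ℂ.exp z₋ k)
      ≈⟨ +-cong (ψ-exp z₊ k) (ψ-exp z₋ k) ⟩
    Re (z₊ ℂ.^ k) * 1/! k + Re (z₋ ℂ.^ k) * 1/! k
      ≈⟨ distribʳ _ _ _ ⟨
    (Re (z₊ ℂ.^ k) + Re (z₋ ℂ.^ k)) * 1/! k
      ≈⟨ *-congʳ (Re-powers k) ⟩
    lacunary 0 (_/ 4) k * 1/! k ∎
    where open Linear Re-isLinear

  -- The left-hand sides of the relations, for a series L whose coefficient of tᵏ
  -- is the lacunary coefficient divided by k!.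
  ∑-mod4 : ∀ r e {L} → L ≋ (λ k → lacunary r e k * 1/! k) → ∀ f p →
    (∑[ k ≤ p ][≡ r mod4]
      ((p C k) · (2^ (+ 1 ℤ.- + (k / 2)) * (- 1#) ^ e k
                    * egfCoefficient f (+ p ℤ.- + k))))
    ≈ (p !) · (L ⊛ f) p
  ∑-mod4 r e {L} L≋ f p = begin
    (∑[ k ≤ p ][≡ r mod4] ((p C k) · (2^ (+ 1 ℤ.- + (k / 2)) * (- 1#) ^ e k * u k)))
      ≈⟨ ∑-cong p (λ k _ → term k) ⟩
    (∑[ k ≤ p ] (p C k) · (lacunary r e k * u k))
      ≈⟨ egfCoefficient-⊛ (lacunary r e) f p ⟩
    (p !) · ((λ k → lacunary r e k * 1/! k) ⊛ f) p
      ≈⟨ ×-congʳ (p !) (at (S.*-congʳ {f} L≋) p) ⟨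
    (p !) · (L ⊛ f) p ∎
    where
    u : ℕ → Carrier
    u k = egfCoefficient f (+ p ℤ.- + k)
    term : ∀ k →
      (if does (k % 4 ℕ.≟ r)
        then (p C k) · (2^ (+ 1 ℤ.- + (k / 2)) * (- 1#) ^ e k * u k) else 0#)
      ≈ (p C k) · (lacunary r e k * u k)
    term k with does (k % 4 ℕ.≟ r)
    ... | true  = refl
    ... | false = sym (trans (×-congʳ (p C k) (zeroˡ (u k)))
                        (trans (·≈*1 (p C k) 0#) (zeroʳ _)))

  -- The right-hand sides of the relations, for a complex generating function Q′
  -- of order α at argument 0 that has the coefficients of Q.
  ψ-polynomial : ∀ {ψ} → IsLinear ψ → ∀ {Q Q′} → map Q ℂ.≋ Q′ → ∀ n x k →
    n · egfCoefficient (Q ⊛ exp x ⊛ s[ ψ ]) k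
    ≈ ψ (n ℂ.· ℂ.egfCoefficient (Q′ ℂ.⊛ ℂ.exp (real x ℂ.- ½[1+i])) k)
  ψ-polynomial {ψ} isLinear {Q} {Q′} Q≋Q′ n x k = begin
    n · egfCoefficient (Q ⊛ exp x ⊛ s[ ψ ]) k
      ≈⟨ ×-congʳ n (egfCoefficient-cong (ψ-product x (-ᶜ ½[1+i]) Q≋Q′) k) ⟨
    n · egfCoefficient (ψ ∘ F) k
      ≈⟨ ×-congʳ n (ψ-egfCoefficient F k) ⟨
    n · ψ (ℂ.egfCoefficient F k)
      ≈⟨ ψ-· n (ℂ.egfCoefficient F k) ⟨
    ψ (n ℂ.· ℂ.egfCoefficient F k) ∎
    where
    open Linear isLinear
    F = Q′ ℂ.⊛ ℂ.exp (real x ℂ.- ½[1+i])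

  bernoulli-relation : ∀ α x p →
    (∑[ k ≤ p ][≡ 2 mod4]
      ((p C k) · (2^ (+ 1 ℤ.- + (k / 2)) * (- 1#) ^ ((k ℕ.+ 2) / 4)
                    * bernoulli (α + 1#) (+ p ℤ.- + k) x)))
    ≈ Im (p ℂ.· ℂ.bernoulli (real α) (+ p ℤ.- + 1) (real x ℂ.- ½[1+i]))
  bernoulli-relation α x p = begin
    _ ≈⟨ ∑-mod4 2 (λ k → (k ℕ.+ 2) / 4) Im-lacunary (power bernoulliBase (α + 1#) ⊛ exp x) p ⟩
    (p !) · (((exp 1# ⊖ const 1#) ⊛ s[ Im ]) ⊛ (power bernoulliBase (α + 1#) ⊛ exp x)) p
      ≈⟨ ×-congʳ (p !) (at (bernoulli-product α x s[ Im ]) p) ⟩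
    (p !) · (t ⊛ F) p
      ≈⟨ egfCoefficient-t⊛ F p ⟨
    p · egfCoefficient F (+ p ℤ.- + 1)
      ≈⟨ ψ-polynomial Im-isLinear base p x (+ p ℤ.- + 1) ⟩
    Im (p ℂ.· ℂ.bernoulli (real α) (+ p ℤ.- + 1) (real x ℂ.- ½[1+i])) ∎
    where
    F = power bernoulliBase α ⊛ exp x ⊛ s[ Im ]
    base : map (power bernoulliBase α) ℂ.≋ ℂ.power ℂ.bernoulliBase (real α)
    base = ℂ.S.trans (power-homo bernoulliBase α)
                     (ℂ.power-cong bernoulliBase-homo ℂ.refl)

  euler-relation : ∀ α x p →
    (∑[ k ≤ p ][≡ 0 mod4]
      ((p C k) · (2^ (+ 1 ℤ.- + (k / 2)) * (- 1#) ^ (k / 4)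
                    * euler (α + 1#) (+ p ℤ.- + k) x)))
    ≈ Re (2 ℂ.· ℂ.euler (real α) (+ p) (real x ℂ.- ½[1+i]))
  euler-relation α x p = begin
    _ ≈⟨ ∑-mod4 0 (_/ 4) Re-lacunary (power eulerBase (α + 1#) ⊛ exp x) p ⟩
    (p !) · (((exp 1# ⊕ const 1#) ⊛ s[ Re ]) ⊛ (power eulerBase (α + 1#) ⊛ exp x)) p
      ≈⟨ ×-congʳ (p !) (at (euler-product α x s[ Re ]) p) ⟩
    (p !) · (const (2 · 1#) ⊛ F) p
      ≈⟨ ·-const-⊛ 2 (p !) F p ⟩
    2 · egfCoefficient F (+ p)
      ≈⟨ ψ-polynomial Re-isLinear base 2 x (+ p) ⟩
    Re (2 ℂ.· ℂ.euler (real α) (+ p) (real x ℂ.- ½[1+i])) ∎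
    where
    F = power eulerBase α ⊛ exp x ⊛ s[ Re ]
    base : map (power eulerBase α) ℂ.≋ ℂ.power ℂ.eulerBase (real α)
    base = ℂ.S.trans (power-homo eulerBase α)
                     (ℂ.power-cong eulerBase-homo ℂ.refl)

  genocchi-relation : ∀ m x p →
    (∑[ k ≤ p ][≡ 0 mod4]
      ((p C k) · (2^ (+ 1 ℤ.- + (k / 2)) * (- 1#) ^ (k / 4)
                    * genocchi (m ℕ.+ 1) (+ p ℤ.- + k) x)))
    ≈ Re ((2 ℕ.* p) ℂ.· ℂ.genocchi m (+ p ℤ.- + 1) (real x ℂ.- ½[1+i]))
  genocchi-relation m x p = begin
    _ ≈⟨ ∑-mod4 0 (_/ 4) Re-lacunary (pow genocchiBase (m ℕ.+ 1) ⊛ exp x) p ⟩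
    (p !) · (((exp 1# ⊕ const 1#) ⊛ s[ Re ]) ⊛ (pow genocchiBase (m ℕ.+ 1) ⊛ exp x)) p
      ≈⟨ ×-congʳ (p !) (at (genocchi-product m x s[ Re ]) p) ⟩
    (p !) · (const (2 · 1#) ⊛ (t ⊛ F)) p
      ≈⟨ ·-const-⊛ 2 (p !) (t ⊛ F) p ⟩
    2 · (p !) · (t ⊛ F) p
      ≈⟨ ×-congʳ 2 (egfCoefficient-t⊛ F p) ⟨
    2 · p · egfCoefficient F (+ p ℤ.- + 1)
      ≈⟨ ×-assocˡ (egfCoefficient F (+ p ℤ.- + 1)) 2 p ⟩
    (2 ℕ.* p) · egfCoefficient F (+ p ℤ.- + 1)
      ≈⟨ ψ-polynomial Re-isLinear base (2 ℕ.* p) x (+ p ℤ.- + 1) ⟩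
    Re ((2 ℕ.* p) ℂ.· ℂ.genocchi m (+ p ℤ.- + 1) (real x ℂ.- ½[1+i])) ∎
    where
    F = pow genocchiBase m ⊛ exp x ⊛ s[ Re ]
    base : map (pow genocchiBase m) ℂ.≋ ℂ.pow ℂ.genocchiBase m
    base = ℂ.S.trans (pow-homo genocchiBase m) (ℂ.pow-cong m genocchiBase-homo)


corollary3 : ∀ {c ℓ} (A : ℚ-Algebra c ℓ) →
    let open ℚ-Algebra A
        open Polynomials A
        open Complexification A
        module ℂ = ℚ-Algebra complexification
        module P = Polynomials complexification
        ½[1+i] = (ℂ.1/ 2) ℂ.* (ℂ.1# ℂ.+ i)
    in
    (α x : Carrier) (p : ℕ) →
      ((∑[ k ≤ p ][≡ 2 mod4]
          ((p C k) · (2^ (+ 1 ℤ.- + (k / 2)) * (- 1#) ^ ((k ℕ.+ 2) / 4)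
                        * bernoulli (α + 1#) (+ p ℤ.- + k) x)))
        ≈ Im (p ℂ.· P.bernoulli (real α) (+ p ℤ.- + 1) (real x ℂ.- ½[1+i])))
      ×
      ((∑[ k ≤ p ][≡ 0 mod4]
          ((p C k) · (2^ (+ 1 ℤ.- + (k / 2)) * (- 1#) ^ (k / 4)
                        * euler (α + 1#) (+ p ℤ.- + k) x)))
        ≈ Re (2 ℂ.· P.euler (real α) (+ p) (real x ℂ.- ½[1+i])))
      ×
      ((m : ℕ) →
        (∑[ k ≤ p ][≡ 0 mod4]
          ((p C k) · (2^ (+ 1 ℤ.- + (k / 2)) * (- 1#) ^ (k / 4)
                        * genocchi (m ℕ.+ 1) (+ p ℤ.- + k) x)))
        ≈ Re ((2 ℕ.* p) ℂ.· P.genocchi m (+ p ℤ.- + 1) (real x ℂ.- ½[1+i])))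
corollary3 A α x p =
  bernoulli-relation α x p , euler-relation α x p , λ m → genocchi-relation m x p
  where open LacunaryRelations A
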